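{- For nonnegative integers $q$, $r$, and $n$, we have $$\sum_{k=l}^{n}\genfrac{[}{]}{0pt}{}{n+r}{k+r}_{r}k(k-1)\cdots(k-l+1)\,B_{k-l}(q)=n!\binom{n+q+r-1}{q+r-2}P(l+1,\,n+q+r-1,\,q+r-2),$$ where $l$ is a nonnegative integer.
   Context: The $r$-Stirling numbers of the first kind $\genfrac{[}{]}{0pt}{}{n+r}{k+r}_{r}$ are defined by $(x+r)(x+r+1)\cdots(x+r+n-1)=\sum_{k=0}^{n}\genfrac{[}{]}{0pt}{}{n+r}{k+r}_{r}x^{k}$. $B_k(x)$ are the Bernoulli polynomials, $\frac{te^{xt}}{e^t-1}=\sum_{k\ge0}B_k(x)\frac{t^k}{k!}$. For $l=0$ the product $k(k-1)\cdots(k-l+1)$ is $1$. A sum with $l>n$ is empty (equal to $0$). $H_n^{(s)}=\sum_{k=1}^n 1/k^s$ are the generalized harmonic numbers, with $H_0^{(s)}=0$. The quantity $P(s,m+k,m)$ is defined by $$P(s,m+k,m)=P_{s}\bigl(H_{m+k}^{(1)}-H_{m}^{(1)},\,H_{m+k}^{(2)}-H_{m}^{(2)},\ldots,H_{m+k}^{(s)}-H_{m}^{(s)}\bigr),$$ where the polynomials $P_s$ are given by $P_0=1$ and $$P_{s}(x_{1},\ldots,x_{s})=(-1)^{s}Y_{s}(-0!\,x_{1},-1!\,x_{2},\ldots,-(s-1)!\,x_{s}),$$ and $Y_s$ is the (complete) exponential Bell polynomial, $\exp\bigl(\sum_{j\ge1}y_j\frac{t^j}{j!}\bigr)=\sum_{s\ge0}Y_s(y_1,\ldots,y_s)\frac{t^s}{s!}$.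 For example $P_1=x_1$, $P_2=x_1^2-x_2$, $P_3=x_1^3-3x_1x_2+2x_3$.
   Formalization: The formal theorem assumes q + r ≥ 2, since for q + r = 0 or 1 the right-hand side involves harmonic numbers and a binomial coefficient with negative index q + r − 2, which are not defined. -}

module Defs where

open import Algebra.Bundles using (RawSemiring)
open import Algebra.Definitions.RawSemiring as RawSemiringOps using ()
open import Algebra.Properties.Monoid.Sum as MonoidSum using ()
open import Data.Fin.Base using (toℕ)
open import Data.Integer.Base as ℤ using ()
open import Data.Nat.Base as ℕ using (ℕ; zero; suc; _∸_; _!)
open import Data.Nat.Properties using (_!≢0; m^n≢0)
open import Data.Rational.Base using (ℚ; 0ℚ; 1ℚ; _+_; _*_; _-_; -_; _/_; +-*-rawSemiring)
open import Data.Rational.Properties using (+-0-monoid)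
open import Level using (0ℓ)
open import Relation.Binary.PropositionalEquality using (_≗_)

open MonoidSum +-0-monoid public using (sum-syntax; sum⁺-syntax)
open RawSemiringOps +-*-rawSemiring public using (_^_)

fromℕ : ℕ → ℚ
fromℕ n = ℤ.+ n / 1

1/_! : ℕ → ℚ
1/ k ! = (ℤ.+ 1 / k !) {{k !≢0}}

-- Σ_{k=l}^{n} f k, which is 0 when l > n.
sumFromTo : ℕ → ℕ → (ℕ → ℚ) → ℚ
sumFromTo l n f = ∑[ i < suc n ∸ l ] f (l ℕ.+ toℕ i)

-- Formal power series over ℚ: a n is the coefficient of tⁿ.  A polynomial is
-- the series of its coefficients.
Series : Set
Series = ℕ → ℚ

constant : ℚ → Series
constant c zero    = c
constant c (suc _) = 0ℚ

indeterminate : Series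
indeterminate 1 = 1ℚ
indeterminate _ = 0ℚ

infixl 6 _⊕_ _⊖_
infixl 7 _⊛_

_⊕_ : Series → Series → Series
(a ⊕ b) n = a n + b n

_⊖_ : Series → Series → Series
(a ⊖ b) n = a n - b n

_⊛_ : Series → Series → Series
(a ⊛ b) n = ∑[ i ≤ n ] (a (toℕ i) * b (n ∸ toℕ i))

series-rawSemiring : RawSemiring 0ℓ 0ℓ
series-rawSemiring = record
  { Carrier = Series
  ; _≈_     = _≗_
  ; _+_     = _⊕_
  ; _*_     = _⊛_
  ; 0#      = constant 0ℚ
  ; 1#      = constant 1ℚ
  }

module SeriesOps = RawSemiringOps series-rawSemiring

-- Σ_k c_k f^k.  Only meaningful when f has zero constant term: then f^k has no
-- terms below t^k, so the coefficient of tⁿ only involves k ≤ n.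
compose : Series → Series → Series
compose c f n = ∑[ k ≤ n ] (c (toℕ k) * (f SeriesOps.^ toℕ k) n)

-- exp f, for f with zero constant term.
exp : Series → Series
exp = compose 1/_!

-- 1 / a as the geometric series Σ_k (1 - a)^k, for a with constant term 1.
inverse : Series → Series
inverse a = compose (λ _ → 1ℚ) (constant 1ℚ ⊖ a)

-- a / t, for a with zero constant term.
divideByT : Series → Series
divideByT a n = a (suc n)

-- rStirling₁ r n k is the number written [ n+r , k+r ]_r: the coefficient of
-- x^k in (x + r)(x + r + 1)⋯(x + r + n - 1).
rStirling₁ : ℕ → ℕ → ℕ → ℚ
rStirling₁ r n =
  SeriesOps.product {n} (λ i → indeterminate ⊕ constant (fromℕ (r ℕ.+ toℕ i)))

exp[_t] : ℚ → Series
exp[ x t] = exp (constant x ⊛ indeterminate)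

-- t e^{xt} / (e^t - 1) is computed as e^{xt} · 1 / ((e^t - 1) / t).
bernoulli : ℕ → ℚ → ℚ
bernoulli k x =
  fromℕ (k !) * (exp[ x t] ⊛ inverse (divideByT (exp[ 1ℚ t] ⊖ constant 1ℚ))) k

-- Σ_{j≥1} y_j t^j / j!.  The entry y 0 is ignored.
egfFrom1 : (ℕ → ℚ) → Series
egfFrom1 y zero    = 0ℚ
egfFrom1 y (suc j) = y (suc j) * 1/ suc j !

-- The variables y_1 , y_2 , … are passed as a sequence; Y_s depends only on
-- y_1 , … , y_s.
completeBell : ℕ → (ℕ → ℚ) → ℚ
completeBell s y = fromℕ (s !) * exp (egfFrom1 y) s

-- P_s(x_1 , … , x_s), with the same convention for the variables.
bellP : ℕ → (ℕ → ℚ) → ℚ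
bellP s x = (- 1ℚ) ^ s * completeBell s (λ j → - (fromℕ ((j ∸ 1) !) * x j))

-- harmonic s n is H_n^{(s)}.
harmonic : ℕ → ℕ → ℚ
harmonic s n =
  ∑[ i < n ] (ℤ.+ 1 / (suc (toℕ i) ℕ.^ s)) {{m^n≢0 (suc (toℕ i)) s}}

-- P(s , N , m); the source writes N as m + k.
harmonicP : ℕ → ℕ → ℕ → ℚ
harmonicP s N m = bellP s (λ j → harmonic j N - harmonic j m)

{-# OPTIONS --safe #-}
module Submission where

-- Put D = d/dt, G = t / (e^t - 1), m = q + r - 2, and write p_{r,n}(x) for
-- (x + r)⋯(x + r + n - 1).  The constant term of p(D) a is Σ_k p_k k! a_k, so
-- the left-hand side is the constant term of p_{r,n}(D) (e^{qt} t^l G), that is,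
-- of p_{m+2,n}(D) (t^l G), because commuting D past e^{qt} turns it into D + q.
-- Since e^t t^l G - t^l G = t^{l+1}, commuting past e^t likewise gives
-- (n + 1) p_{m+2,n}(D) (t^l G) = p_{m+1,n+1}(D) t^{l+1} at 0, which is
-- (l + 1)! times the coefficient of x^{l+1} in p_{m+1,n+1}.  That coefficient is
-- (m + n + 1)! / m! times an elementary symmetric polynomial in the numbers
-- 1 / (m + 1), …, 1 / (m + n + 1), and these have the generating function
-- ∏ (1 + a_i t) = exp (- Σ_j (- t)^j H_j / j) with H_j the power sums.

open import Defs
open import Algebra.Bundles using (CommutativeRing)
import Algebra.Properties.CommutativeSemigroup as CommutativeSemigroupProperties
import Algebra.Properties.Monoid.Sum as MonoidSum
import Data.Fin.Base as Fin
open import Data.Fin.Base using (Fin; toℕ)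
open import Data.Fin.Properties using (toℕ-inject₁; toℕ-fromℕ)
import Data.Integer.Base as ℤ
import Data.Integer.Properties as ℤ
import Data.Nat.Base as ℕ
open import Data.Nat.Base using (ℕ; zero; suc; _≤_; _<_; _∸_; _!; z≤n; s≤s; z<s; s<s)
open import Data.Nat.Combinatorics using (_C_; _P_; k![n∸k]!∣n!)
open import Data.Nat.Combinatorics.Specification using (nPk≡n!/[n∸k]!; nCk≡n!/k![n-k]!)
open import Data.Nat.Divisibility using (m≤n⇒m!∣n!)
import Data.Nat.DivMod as ℕ
import Data.Nat.Properties as ℕ
open import Data.Product.Base using (_,_)
open import Data.Rational.Base using (ℚ; 0ℚ; 1ℚ; _+_; _*_; _-_; -_; _/_; fromℚᵘ)
open import Data.Rational.Properties
open import Data.Rational.Solver using (module +-*-Solver)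
import Data.Rational.Unnormalised.Base as ℚᵘ
import Data.Rational.Unnormalised.Properties as ℚᵘ
open import Level using (0ℓ)
open import Relation.Binary.PropositionalEquality using (_≡_; _≗_; refl; sym; trans; cong; cong₂; module ≡-Reasoning)
open import Algebra.Properties.Semiring.Sum (CommutativeRing.semiring +-*-commutativeRing)
  using (sum-cong-≗; sum-replicate-zero; *-distribˡ-sum; ∑-distrib-+; sum-init-last)

open ≡-Reasoning
open +-*-Solver using (solve; _:+_; _:*_; _:-_; :-_; _:=_; con)

-- The ring of formal power series

-- `_⊛_` unfolds by splitting off the constant term of its left factor. This is the mirror recursion
-- on the right factor, which the induction for commutativity needs.
⊛-snoc : ∀ a b n → (a ⊛ b) (suc n) ≡ (a ⊛ divideByT b) n + a (suc n) * b 0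
⊛-snoc a b zero =
  solve 3 (λ x y z → x :+ (y :+ z) := (x :+ z) :+ y) refl (a 0 * b 1) (a 1 * b 0) 0ℚ
⊛-snoc a b (suc n) = begin
  a 0 * b (2 ℕ.+ n) + (divideByT a ⊛ b) (suc n)
    ≡⟨ cong (a 0 * b (2 ℕ.+ n) +_) (⊛-snoc (divideByT a) b n) ⟩
  a 0 * b (2 ℕ.+ n) + ((divideByT a ⊛ divideByT b) n + a (2 ℕ.+ n) * b 0)
    ≡⟨ +-assoc (a 0 * b (2 ℕ.+ n)) _ _ ⟨
  (a ⊛ divideByT b) (suc n) + a (2 ℕ.+ n) * b 0 ∎

⊛-comm : ∀ a b → a ⊛ b ≗ b ⊛ a
⊛-comm a b zero = cong (_+ 0ℚ) (*-comm (a 0) (b 0))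
⊛-comm a b (suc n) = begin
  a 0 * b (suc n) + (divideByT a ⊛ b) n  ≡⟨ cong₂ _+_ (*-comm (a 0) (b (suc n))) (⊛-comm (divideByT a) b n) ⟩
  b (suc n) * a 0 + (b ⊛ divideByT a) n  ≡⟨ +-comm (b (suc n) * a 0) _ ⟩
  (b ⊛ divideByT a) n + b (suc n) * a 0  ≡⟨ ⊛-snoc b a n ⟨
  (b ⊛ a) (suc n)                        ∎

⊛-cong : ∀ {a a′ b b′} → a ≗ a′ → b ≗ b′ → a ⊛ b ≗ a′ ⊛ b′
⊛-cong p q zero    = cong (_+ 0ℚ) (cong₂ _*_ (p 0) (q 0))
⊛-cong p q (suc n) = cong₂ _+_ (cong₂ _*_ (p 0) (q (suc n))) (⊛-cong (λ i → p (suc i)) q n)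

⊛-zeroˡ : ∀ {z} → (∀ n → z n ≡ 0ℚ) → ∀ a n → (z ⊛ a) n ≡ 0ℚ
⊛-zeroˡ {z} z≡0 a zero    = trans (+-identityʳ (z 0 * a 0)) (trans (cong (_* a 0) (z≡0 0)) (*-zeroˡ (a 0)))
⊛-zeroˡ {z} z≡0 a (suc n) = begin
  z 0 * a (suc n) + (divideByT z ⊛ a) n  ≡⟨ cong₂ _+_ (cong (_* a (suc n)) (z≡0 0)) (⊛-zeroˡ (λ i → z≡0 (suc i)) a n) ⟩
  0ℚ * a (suc n) + 0ℚ                    ≡⟨ +-identityʳ _ ⟩
  0ℚ * a (suc n)                         ≡⟨ *-zeroˡ (a (suc n)) ⟩
  0ℚ                                     ∎

constant-⊛ : ∀ c a n → (constant c ⊛ a) n ≡ c * a n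
constant-⊛ c a zero    = +-identityʳ (c * a 0)
constant-⊛ c a (suc n) =
  trans (cong (c * a (suc n) +_) (⊛-zeroˡ (λ _ → refl) a n)) (+-identityʳ (c * a (suc n)))

⊛-distribʳ : ∀ c a b → (a ⊕ b) ⊛ c ≗ (a ⊛ c) ⊕ (b ⊛ c)
⊛-distribʳ c a b zero =
  solve 3 (λ x y z → (x :+ y) :* z :+ con 0ℚ := (x :* z :+ con 0ℚ) :+ (y :* z :+ con 0ℚ)) refl (a 0) (b 0) (c 0)
⊛-distribʳ c a b (suc n) = begin
  (a 0 + b 0) * c (suc n) + ((divideByT a ⊕ divideByT b) ⊛ c) n
    ≡⟨ cong ((a 0 + b 0) * c (suc n) +_) (⊛-distribʳ c (divideByT a) (divideByT b) n) ⟩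
  (a 0 + b 0) * c (suc n) + ((divideByT a ⊛ c) n + (divideByT b ⊛ c) n)
    ≡⟨ solve 5 (λ x y z u v → (x :+ y) :* z :+ (u :+ v) := (x :* z :+ u) :+ (y :* z :+ v)) refl
         (a 0) (b 0) (c (suc n)) ((divideByT a ⊛ c) n) ((divideByT b ⊛ c) n) ⟩
  (a ⊛ c) (suc n) + (b ⊛ c) (suc n) ∎

scale-⊛ : ∀ k a b n → ((λ i → k * a i) ⊛ b) n ≡ k * (a ⊛ b) n
scale-⊛ k a b zero =
  solve 3 (λ x y z → x :* y :* z :+ con 0ℚ := x :* (y :* z :+ con 0ℚ)) refl k (a 0) (b 0)
scale-⊛ k a b (suc n) = begin
  k * a 0 * b (suc n) + ((λ i → k * a (suc i)) ⊛ b) n  ≡⟨ cong (k * a 0 * b (suc n) +_) (scale-⊛ k (divideByT a) b n) ⟩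
  k * a 0 * b (suc n) + k * (divideByT a ⊛ b) n
    ≡⟨ solve 4 (λ x y z w → x :* y :* z :+ x :* w := x :* (y :* z :+ w)) refl k (a 0) (b (suc n)) ((divideByT a ⊛ b) n) ⟩
  k * (a ⊛ b) (suc n) ∎

⊛-assoc : ∀ a b c → (a ⊛ b) ⊛ c ≗ a ⊛ (b ⊛ c)
⊛-assoc a b c zero =
  solve 3 (λ x y z → (x :* y :+ con 0ℚ) :* z :+ con 0ℚ := x :* (y :* z :+ con 0ℚ) :+ con 0ℚ) refl (a 0) (b 0) (c 0)
⊛-assoc a b c (suc n) = begin
  (a 0 * b 0 + 0ℚ) * c (suc n) + (divideByT (a ⊛ b) ⊛ c) n
    ≡⟨ cong ((a 0 * b 0 + 0ℚ) * c (suc n) +_) (begin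
         (divideByT (a ⊛ b) ⊛ c) n
           -- By definition `divideByT (a ⊛ b)` is `a 0` times `divideByT b` plus `divideByT a ⊛ b`,
           -- so distributivity leaves a scalar multiple and an instance of the induction
           -- hypothesis.
           ≡⟨ ⊛-distribʳ c (λ i → a 0 * b (suc i)) (divideByT a ⊛ b) n ⟩
         ((λ i → a 0 * b (suc i)) ⊛ c) n + ((divideByT a ⊛ b) ⊛ c) n
           ≡⟨ cong₂ _+_ (scale-⊛ (a 0) (divideByT b) c n) (⊛-assoc (divideByT a) b c n) ⟩
         a 0 * (divideByT b ⊛ c) n + (divideByT a ⊛ (b ⊛ c)) n ∎) ⟩
  (a 0 * b 0 + 0ℚ) * c (suc n) + (a 0 * (divideByT b ⊛ c) n + (divideByT a ⊛ (b ⊛ c)) n)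
    ≡⟨ solve 5 (λ x y z u v → (x :* y :+ con 0ℚ) :* z :+ (x :* u :+ v) := x :* (y :* z :+ u) :+ v) refl
         (a 0) (b 0) (c (suc n)) ((divideByT b ⊛ c) n) ((divideByT a ⊛ (b ⊛ c)) n) ⟩
  (a ⊛ (b ⊛ c)) (suc n) ∎

series-commutativeRing : CommutativeRing 0ℓ 0ℓ
series-commutativeRing = record
  { Carrier = Series
  ; _≈_ = _≗_
  ; _+_ = _⊕_
  ; _*_ = _⊛_
  ; -_ = λ a n → - a n
  ; 0# = constant 0ℚ
  ; 1# = constant 1ℚ
  ; isCommutativeRing = record
    { isRing = record
      { +-isAbelianGroup = record
        { isGroup = record
          { isMonoid = record
            { isSemigroup = record
              { isMagma = record
                { isEquivalence = record
                  { refl  = λ _ → refl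
                  ; sym   = λ p n → sym (p n)
                  ; trans = λ p q n → trans (p n) (q n)
                  }
                ; ∙-cong = λ p q n → cong₂ _+_ (p n) (q n)
                }
              ; assoc = λ a b c n → +-assoc (a n) (b n) (c n)
              }
            ; identity = (λ a n → trans (cong (_+ a n) (zero≗ n)) (+-identityˡ (a n)))
                       , (λ a n → trans (cong (a n +_) (zero≗ n)) (+-identityʳ (a n)))
            }
          ; inverse = (λ a n → trans (+-inverseˡ (a n)) (sym (zero≗ n)))
                    , (λ a n → trans (+-inverseʳ (a n)) (sym (zero≗ n)))
          ; ⁻¹-cong = λ p n → cong -_ (p n)
          }
        ; comm = λ a b n → +-comm (a n) (b n)
        }
      ; *-cong = ⊛-cong
      ; *-assoc = ⊛-assoc
      ; *-identity = identityˡ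
                   , (λ a n → trans (⊛-comm a (constant 1ℚ) n) (identityˡ a n))
      ; distrib = (λ c a b n → begin
                     (c ⊛ (a ⊕ b)) n          ≡⟨ ⊛-comm c (a ⊕ b) n ⟩
                     ((a ⊕ b) ⊛ c) n          ≡⟨ ⊛-distribʳ c a b n ⟩
                     (a ⊛ c) n + (b ⊛ c) n    ≡⟨ cong₂ _+_ (⊛-comm a c n) (⊛-comm b c n) ⟩
                     (c ⊛ a) n + (c ⊛ b) n    ∎)
                , ⊛-distribʳ
      }
    ; *-comm = ⊛-comm
    }
  }
  where
  zero≗ : ∀ n → constant 0ℚ n ≡ 0ℚ
  zero≗ zero    = refl
  zero≗ (suc n) = refl

  identityˡ : ∀ a → constant 1ℚ ⊛ a ≗ a
  identityˡ a n = trans (constant-⊛ 1ℚ a n) (*-identityˡ (a n))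

-- Rational arithmetic and finite sums

-- `_/_` normalises by a gcd and is stuck on variables. Unnormalised fractions add and multiply by
-- formula, so identities are checked there and transported.
fromℚᵘ-homo-+ : ∀ p q → fromℚᵘ (p ℚᵘ.+ q) ≡ fromℚᵘ p + fromℚᵘ q
fromℚᵘ-homo-+ p q = toℚᵘ-injective (ℚᵘ.≃-trans (toℚᵘ-fromℚᵘ (p ℚᵘ.+ q)) (ℚᵘ.≃-sym
  (ℚᵘ.≃-trans (toℚᵘ-homo-+ (fromℚᵘ p) (fromℚᵘ q)) (ℚᵘ.+-cong (toℚᵘ-fromℚᵘ p) (toℚᵘ-fromℚᵘ q)))))

fromℚᵘ-homo-* : ∀ p q → fromℚᵘ (p ℚᵘ.* q) ≡ fromℚᵘ p * fromℚᵘ q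
fromℚᵘ-homo-* p q = toℚᵘ-injective (ℚᵘ.≃-trans (toℚᵘ-fromℚᵘ (p ℚᵘ.* q)) (ℚᵘ.≃-sym
  (ℚᵘ.≃-trans (toℚᵘ-homo-* (fromℚᵘ p) (fromℚᵘ q)) (ℚᵘ.*-cong (toℚᵘ-fromℚᵘ p) (toℚᵘ-fromℚᵘ q)))))

fromℕ-homo-+ : ∀ m n → fromℕ (m ℕ.+ n) ≡ fromℕ m + fromℕ n
fromℕ-homo-+ m n = trans
  (cong (_/ 1) (sym (cong₂ ℤ._+_ (ℤ.*-identityʳ (ℤ.+ m)) (ℤ.*-identityʳ (ℤ.+ n)))))
  (fromℚᵘ-homo-+ (ℚᵘ.mkℚᵘ (ℤ.+ m) 0) (ℚᵘ.mkℚᵘ (ℤ.+ n) 0))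

fromℕ-homo-* : ∀ m n → fromℕ (m ℕ.* n) ≡ fromℕ m * fromℕ n
fromℕ-homo-* m n = trans (cong (_/ 1) (ℤ.pos-* m n))
  (fromℚᵘ-homo-* (ℚᵘ.mkℚᵘ (ℤ.+ m) 0) (ℚᵘ.mkℚᵘ (ℤ.+ n) 0))

1/n*n≡1 : ∀ n .{{_ : ℕ.NonZero n}} → (ℤ.+ 1 / n) * fromℕ n ≡ 1ℚ
1/n*n≡1 n@(suc n-1) = trans
  (sym (fromℚᵘ-homo-* (ℚᵘ.mkℚᵘ (ℤ.+ 1) n-1) (ℚᵘ.mkℚᵘ (ℤ.+ n) 0)))
  (fromℚᵘ-cong {ℚᵘ.mkℚᵘ (ℤ.+ 1) n-1 ℚᵘ.* ℚᵘ.mkℚᵘ (ℤ.+ n) 0} {ℚᵘ.1ℚᵘ} (ℚᵘ.*≡*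
    (trans (ℤ.*-identityʳ _) (trans (ℤ.*-identityˡ (ℤ.+ n))
      (sym (trans (ℤ.*-identityˡ _) (cong (λ k → ℤ.+ suc k) (ℕ.*-identityʳ n-1))))))))

fromℕ-suc-* : ∀ n x → fromℕ (suc n) * x ≡ fromℕ n * x + x
fromℕ-suc-* n x = begin
  fromℕ (suc n) * x   ≡⟨ cong (_* x) (fromℕ-homo-+ 1 n) ⟩
  (1ℚ + fromℕ n) * x  ≡⟨ solve 2 (λ y x → (con 1ℚ :+ y) :* x := y :* x :+ x) refl (fromℕ n) x ⟩
  fromℕ n * x + x     ∎

fromℕ-*-cancelˡ : ∀ n .{{_ : ℕ.NonZero n}} {x y} → fromℕ n * x ≡ fromℕ n * y → x ≡ y
fromℕ-*-cancelˡ n {x} {y} eq = trans (sym (invert x)) (trans (cong (ℤ.+ 1 / n *_) eq) (invert y))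
  where
  invert : ∀ z → (ℤ.+ 1 / n) * (fromℕ n * z) ≡ z
  invert z = begin
    (ℤ.+ 1 / n) * (fromℕ n * z)  ≡⟨ *-assoc (ℤ.+ 1 / n) (fromℕ n) z ⟨
    (ℤ.+ 1 / n) * fromℕ n * z    ≡⟨ cong (_* z) (1/n*n≡1 n) ⟩
    1ℚ * z                       ≡⟨ *-identityˡ z ⟩
    z                            ∎

1/n-unique : ∀ n .{{_ : ℕ.NonZero n}} {x} → x * fromℕ n ≡ 1ℚ → x ≡ ℤ.+ 1 / n
1/n-unique n {x} eq = fromℕ-*-cancelˡ n (begin
  fromℕ n * x            ≡⟨ *-comm (fromℕ n) x ⟩
  x * fromℕ n            ≡⟨ eq ⟩
  1ℚ                     ≡⟨ 1/n*n≡1 n ⟨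
  (ℤ.+ 1 / n) * fromℕ n  ≡⟨ *-comm (ℤ.+ 1 / n) (fromℕ n) ⟩
  fromℕ n * (ℤ.+ 1 / n)  ∎)

1/suc!-* : ∀ k → 1/ suc k ! * fromℕ (suc k) ≡ 1/ k !
1/suc!-* k = 1/n-unique (k !) {{k ℕ.!≢0}} (begin
  1/ suc k ! * fromℕ (suc k) * fromℕ (k !)    ≡⟨ *-assoc (1/ suc k !) _ _ ⟩
  1/ suc k ! * (fromℕ (suc k) * fromℕ (k !))  ≡⟨ cong (1/ suc k ! *_) (fromℕ-homo-* (suc k) (k !)) ⟨
  1/ suc k ! * fromℕ (suc k !)                ≡⟨ 1/n*n≡1 (suc k !) {{suc k ℕ.!≢0}} ⟩
  1ℚ                                          ∎)

sum-zero : ∀ n {g : Fin n → ℚ} → (∀ i → g i ≡ 0ℚ) → ∑[ i < n ] g i ≡ 0ℚ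
sum-zero n g≡0 = trans (sum-cong-≗ g≡0) (sum-replicate-zero n)

sum-extend : ∀ {n N} (g : ℕ → ℚ) → n ≤ N → (∀ k → n ≤ k → g k ≡ 0ℚ) →
  ∑[ i < n ] g (toℕ i) ≡ ∑[ i < N ] g (toℕ i)
sum-extend {zero} {N} g z≤n g≡0 = sym (sum-zero N (λ i → g≡0 (toℕ i) z≤n))
sum-extend {suc n} g (s≤s n≤N) g≡0 =
  cong (g 0 +_) (sum-extend (λ k → g (suc k)) n≤N (λ k n≤k → g≡0 (suc k) (s≤s n≤k)))

⊛-congʳ-≤ : ∀ a {b b′} n → (∀ j → j ≤ n → b j ≡ b′ j) → (a ⊛ b) n ≡ (a ⊛ b′) n
⊛-congʳ-≤ a n b≗b′ =
  sum-cong-≗ {suc n} (λ i → cong (a (toℕ i) *_) (b≗b′ (n ∸ toℕ i) (ℕ.m∸n≤m n (toℕ i))))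

⊛-zeroʳ : ∀ a {b} n → (∀ j → j ≤ n → b j ≡ 0ℚ) → (a ⊛ b) n ≡ 0ℚ
⊛-zeroʳ a n b≡0 = trans (⊛-congʳ-≤ a n b≡0)
  (trans (⊛-comm a (λ _ → 0ℚ) n) (⊛-zeroˡ (λ _ → refl) a n))

⊛-congʳ : ∀ a {b b′} → b ≗ b′ → a ⊛ b ≗ a ⊛ b′
⊛-congʳ a = ⊛-cong {a} (λ _ → refl)

⊛-congˡ : ∀ {a a′} b → a ≗ a′ → a ⊛ b ≗ a′ ⊛ b
⊛-congˡ b p = ⊛-cong {b = b} p (λ _ → refl)

⊛-scaleʳ : ∀ k a b n → (a ⊛ (λ i → k * b i)) n ≡ k * (a ⊛ b) n
⊛-scaleʳ k a b n = begin
  (a ⊛ (λ i → k * b i)) n  ≡⟨ ⊛-comm a (λ i → k * b i) n ⟩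
  ((λ i → k * b i) ⊛ a) n  ≡⟨ scale-⊛ k b a n ⟩
  k * (b ⊛ a) n            ≡⟨ cong (k *_) (⊛-comm b a n) ⟩
  k * (a ⊛ b) n            ∎

⊛-distribˡ : ∀ c a b → c ⊛ (a ⊕ b) ≗ (c ⊛ a) ⊕ (c ⊛ b)
⊛-distribˡ = CommutativeRing.distribˡ series-commutativeRing

⊛-sumʳ : ∀ a N (h : Fin N → Series) n →
  (a ⊛ (λ j → ∑[ i < N ] h i j)) n ≡ ∑[ i < N ] (a ⊛ h i) n
⊛-sumʳ a zero h n = ⊛-zeroʳ a n (λ _ _ → refl)
⊛-sumʳ a (suc N) h n = trans
  (⊛-distribˡ a (h Fin.zero) (λ j → ∑[ i < N ] h (Fin.suc i) j) n)
  (cong ((a ⊛ h Fin.zero) n +_) (⊛-sumʳ a N (λ i → h (Fin.suc i)) n))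

-- Composition of power series

infixr 8 _^ˢ_
_^ˢ_ : Series → ℕ → Series
_^ˢ_ = SeriesOps._^_

^-vanishes : ∀ f → f 0 ≡ 0ℚ → ∀ {k n} → n < k → (f ^ˢ k) n ≡ 0ℚ
^-vanishes f f₀ {suc k} {zero} _ = begin
  f 0 * (f ^ˢ k) 0 + 0ℚ  ≡⟨ +-identityʳ _ ⟩
  f 0 * (f ^ˢ k) 0       ≡⟨ cong (_* (f ^ˢ k) 0) f₀ ⟩
  0ℚ * (f ^ˢ k) 0        ≡⟨ *-zeroˡ ((f ^ˢ k) 0) ⟩
  0ℚ                     ∎
^-vanishes f f₀ {suc k} {suc n} (s<s n<k) = begin
  f 0 * (f ^ˢ k) (suc n) + (divideByT f ⊛ (f ^ˢ k)) n
    ≡⟨ cong₂ _+_ (cong (_* (f ^ˢ k) (suc n)) f₀) (⊛-zeroʳ (divideByT f) n (λ j j≤n → ^-vanishes f f₀ (ℕ.≤-<-trans j≤n n<k))) ⟩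
  0ℚ * (f ^ˢ k) (suc n) + 0ℚ
    ≡⟨ trans (+-identityʳ _) (*-zeroˡ ((f ^ˢ k) (suc n))) ⟩
  0ℚ ∎

-- `compose` sums up to the coefficient index itself. A bound common to several coefficients is
-- needed before the sum can be exchanged with a convolution; the extra terms vanish because
-- `f ^ˢ k` has order at least `k`.
compose-extend : ∀ c f → f 0 ≡ 0ℚ → ∀ {n N} → n ≤ N →
  compose c f n ≡ ∑[ k ≤ N ] (c (toℕ k) * (f ^ˢ toℕ k) n)
compose-extend c f f₀ {n} n≤N = sum-extend (λ k → c k * (f ^ˢ k) n) (s≤s n≤N)
  (λ k n<k → trans (cong (c k *_) (^-vanishes f f₀ n<k)) (*-zeroʳ (c k)))

⊛-compose : ∀ g c f → f 0 ≡ 0ℚ → ∀ n →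
  (g ⊛ compose c f) n ≡ ∑[ k ≤ n ] (c (toℕ k) * (g ⊛ (f ^ˢ toℕ k)) n)
⊛-compose g c f f₀ n = begin
  (g ⊛ compose c f) n
    ≡⟨ ⊛-congʳ-≤ g {compose c f} {λ j → ∑[ k ≤ n ] (c (toℕ k) * (f ^ˢ toℕ k) j)} n (λ j → compose-extend c f f₀) ⟩
  (g ⊛ (λ j → ∑[ k ≤ n ] (c (toℕ k) * (f ^ˢ toℕ k) j))) n
    ≡⟨ ⊛-sumʳ g (suc n) (λ k j → c (toℕ k) * (f ^ˢ toℕ k) j) n ⟩
  ∑[ k ≤ n ] ((g ⊛ (λ j → c (toℕ k) * (f ^ˢ toℕ k) j)) n)
    ≡⟨ sum-cong-≗ (λ (k : Fin (suc n)) → ⊛-scaleʳ (c (toℕ k)) g (f ^ˢ toℕ k) n) ⟩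
  ∑[ k ≤ n ] (c (toℕ k) * (g ⊛ (f ^ˢ toℕ k)) n) ∎

-- Splitting `c = c 0 + t c′` with `c′ = divideByT c` gives `c(f) = c 0 + f c′(f)`. The bound is
-- raised to `suc n` so that `n + 1` terms remain after `k = 0`, as in `⊛-compose`.
compose-unfold : ∀ c f → f 0 ≡ 0ℚ → ∀ n →
  compose c f n ≡ c 0 * constant 1ℚ n + (f ⊛ compose (divideByT c) f) n
compose-unfold c f f₀ n = trans (compose-extend c f f₀ (ℕ.n≤1+n n))
  (cong (c 0 * constant 1ℚ n +_) (sym (⊛-compose f (divideByT c) f f₀ n)))

-- For `u = 1 - a` the geometric series satisfies `I = 1 + u I`, while `u + a = 1` gives
-- `u I + a I = I`; comparing the two leaves `a I = 1`.
⊛-inverseʳ : ∀ {a} → a 0 ≡ 1ℚ → a ⊛ inverse a ≗ constant 1ℚ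
⊛-inverseʳ {a} a₀ n = begin
  (a ⊛ I) n
    ≡⟨ solve 2 (λ x y → x := y :+ x :- y) refl ((a ⊛ I) n) (I n) ⟩
  I n + (a ⊛ I) n - I n
    ≡⟨ cong (λ z → z + (a ⊛ I) n - I n) (compose-unfold (λ _ → 1ℚ) u (cong (λ x → 1ℚ - x) a₀) n) ⟩
  1ℚ * constant 1ℚ n + (u ⊛ I) n + (a ⊛ I) n - I n
    ≡⟨ solve 4 (λ x y z w → con 1ℚ :* x :+ y :+ z :- w := x :+ (y :+ z :- w)) refl (constant 1ℚ n) ((u ⊛ I) n) ((a ⊛ I) n) (I n) ⟩
  constant 1ℚ n + ((u ⊛ I) n + (a ⊛ I) n - I n)
    ≡⟨ cong (λ z → constant 1ℚ n + (z - I n)) (begin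
         (u ⊛ I) n + (a ⊛ I) n  ≡⟨ ⊛-distribʳ I u a n ⟨
         ((u ⊕ a) ⊛ I) n        ≡⟨ ⊛-congˡ I (λ i → solve 2 (λ x y → x :- y :+ y := x) refl (constant 1ℚ i) (a i)) n ⟩
         (constant 1ℚ ⊛ I) n    ≡⟨ constant-⊛ 1ℚ I n ⟩
         1ℚ * I n               ∎) ⟩
  constant 1ℚ n + (1ℚ * I n - I n)
    ≡⟨ solve 2 (λ x y → x :+ (con 1ℚ :* y :- y) := x) refl (constant 1ℚ n) (I n) ⟩
  constant 1ℚ n ∎
  where
  u I : Series
  u = constant 1ℚ ⊖ a
  I = inverse a

-- The derivation d/dt and the exponential series

D : Series → Series
D a n = fromℕ (suc n) * a (suc n)

D-cong : ∀ {a b} → a ≗ b → D a ≗ D b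
D-cong p n = cong (fromℕ (suc n) *_) (p (suc n))

-- Write `a = a 0 + t a′`. The weight `n + 2` on the tail splits as `(n + 1) + 1`: the first part is
-- the induction hypothesis for `a′`, and the extra copy of `a′ ⊛ b` accounts for the summand `a′`
-- in `D a = a′ + t D a′`.
D-⊛ : ∀ a b → D (a ⊛ b) ≗ (D a ⊛ b) ⊕ (a ⊛ D b)
D-⊛ a b zero = solve 4 (λ a₀ a₁ b₀ b₁ →
    con 1ℚ :* (a₀ :* b₁ :+ (a₁ :* b₀ :+ con 0ℚ)) :=
    (con 1ℚ :* a₁ :* b₀ :+ con 0ℚ) :+ (a₀ :* (con 1ℚ :* b₁) :+ con 0ℚ))
  refl (a 0) (a 1) (b 0) (b 1)
D-⊛ a b (suc n) = begin
  D (a ⊛ b) (suc n)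
    ≡⟨⟩
  fromℕ (2 ℕ.+ n) * (a 0 * b (2 ℕ.+ n) + (a′ ⊛ b) (suc n))
    ≡⟨ *-distribˡ-+ (fromℕ (2 ℕ.+ n)) (a 0 * b (2 ℕ.+ n)) ((a′ ⊛ b) (suc n)) ⟩
  fromℕ (2 ℕ.+ n) * (a 0 * b (2 ℕ.+ n)) + fromℕ (2 ℕ.+ n) * (a′ ⊛ b) (suc n)
    ≡⟨ cong (fromℕ (2 ℕ.+ n) * (a 0 * b (2 ℕ.+ n)) +_) 
         (trans (fromℕ-suc-* (suc n) ((a′ ⊛ b) (suc n))) (cong (_+ (a′ ⊛ b) (suc n)) (D-⊛ a′ b n))) ⟩
  fromℕ (2 ℕ.+ n) * (a 0 * b (2 ℕ.+ n)) + ((D a′ ⊛ b) n + (a′ ⊛ D b) n + (a 1 * b (suc n) + (a″ ⊛ b) n))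
    ≡⟨ solve 8 (λ s a₀ bₙ p q a₁ b₁ t → s :* (a₀ :* bₙ) :+ (p :+ q :+ (a₁ :* b₁ :+ t)) :=
                 (con 1ℚ :* a₁ :* b₁ :+ (p :+ t)) :+ (a₀ :* (s :* bₙ) :+ q)) refl
         (fromℕ (2 ℕ.+ n)) (a 0) (b (2 ℕ.+ n)) ((D a′ ⊛ b) n) ((a′ ⊛ D b) n) (a 1) (b (suc n)) ((a″ ⊛ b) n) ⟩
  (D a 0 * b (suc n) + ((D a′ ⊛ b) n + (a″ ⊛ b) n)) + (a ⊛ D b) (suc n)
    ≡⟨ cong (λ z → (D a 0 * b (suc n) + z) + (a ⊛ D b) (suc n))
         (trans (sym (⊛-distribʳ b (D a′) a″ n)) (⊛-congˡ b (λ i → sym (fromℕ-suc-* (suc i) (a (2 ℕ.+ i)))) n)) ⟩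
  (D a ⊛ b) (suc n) + (a ⊛ D b) (suc n) ∎
  where
  a′ a″ : Series
  a′ = divideByT a
  a″ = divideByT a′

D-constant : ∀ c n → D (constant c) n ≡ 0ℚ
D-constant c n = *-zeroʳ (fromℕ (suc n))

D-^ : ∀ f k n → D (f ^ˢ suc k) n ≡ fromℕ (suc k) * (D f ⊛ (f ^ˢ k)) n
D-^ f zero n = begin
  D (f ⊛ constant 1ℚ) n                                  ≡⟨ D-⊛ f (constant 1ℚ) n ⟩
  (D f ⊛ constant 1ℚ) n + (f ⊛ D (constant 1ℚ)) n        ≡⟨ cong ((D f ⊛ constant 1ℚ) n +_) (⊛-zeroʳ f n (λ j _ → D-constant 1ℚ j)) ⟩
  (D f ⊛ constant 1ℚ) n + 0ℚ                             ≡⟨ +-identityʳ _ ⟩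
  (D f ⊛ constant 1ℚ) n                                  ≡⟨ *-identityˡ _ ⟨
  1ℚ * (D f ⊛ constant 1ℚ) n                             ∎
D-^ f (suc k) n = begin
  D (f ⊛ (f ^ˢ suc k)) n
    ≡⟨ D-⊛ f (f ^ˢ suc k) n ⟩
  (D f ⊛ (f ^ˢ suc k)) n + (f ⊛ D (f ^ˢ suc k)) n
    ≡⟨ cong ((D f ⊛ (f ^ˢ suc k)) n +_) (begin
         (f ⊛ D (f ^ˢ suc k)) n
           ≡⟨ ⊛-congʳ f (D-^ f k) n ⟩
         (f ⊛ (λ i → fromℕ (suc k) * (D f ⊛ (f ^ˢ k)) i)) n
           ≡⟨ ⊛-scaleʳ (fromℕ (suc k)) f (D f ⊛ (f ^ˢ k)) n ⟩
         fromℕ (suc k) * (f ⊛ (D f ⊛ (f ^ˢ k))) n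
           ≡⟨ cong (fromℕ (suc k) *_) (trans (sym (⊛-assoc f (D f) (f ^ˢ k) n))
                (trans (⊛-congˡ (f ^ˢ k) (⊛-comm f (D f)) n) (⊛-assoc (D f) f (f ^ˢ k) n))) ⟩
         fromℕ (suc k) * (D f ⊛ (f ^ˢ suc k)) n ∎) ⟩
  (D f ⊛ (f ^ˢ suc k)) n + fromℕ (suc k) * (D f ⊛ (f ^ˢ suc k)) n
    ≡⟨ +-comm ((D f ⊛ (f ^ˢ suc k)) n) _ ⟩
  fromℕ (suc k) * (D f ⊛ (f ^ˢ suc k)) n + (D f ⊛ (f ^ˢ suc k)) n
    ≡⟨ fromℕ-suc-* (suc k) ((D f ⊛ (f ^ˢ suc k)) n) ⟨
  fromℕ (2 ℕ.+ k) * (D f ⊛ (f ^ˢ suc k)) n ∎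

D-exp : ∀ f → f 0 ≡ 0ℚ → D (exp f) ≗ D f ⊛ exp f
D-exp f f₀ n = begin
  -- The product `1ℚ * 0ℚ` is the term `k = 0`, as `f ^ˢ 0` is constant. In the others the power
  -- rule brings down `k + 1`, which turns `1 / (k + 1)!` into `1 / k!`.
  fromℕ (suc n) * (1ℚ * 0ℚ + ∑[ k ≤ n ] term k)
    ≡⟨ cong (fromℕ (suc n) *_) (+-identityˡ _) ⟩
  fromℕ (suc n) * ∑[ k ≤ n ] term k
    ≡⟨ *-distribˡ-sum (fromℕ (suc n)) term ⟩
  ∑[ k ≤ n ] (fromℕ (suc n) * term k)
    ≡⟨ sum-cong-≗ step ⟩
  ∑[ k ≤ n ] (1/ toℕ k ! * (D f ⊛ (f ^ˢ toℕ k)) n)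
    ≡⟨ ⊛-compose (D f) 1/_! f f₀ n ⟨
  (D f ⊛ exp f) n ∎
  where
  term : Fin (suc n) → ℚ
  term k = 1/ suc (toℕ k) ! * (f ^ˢ suc (toℕ k)) (suc n)

  step : ∀ k → fromℕ (suc n) * term k ≡ 1/ toℕ k ! * (D f ⊛ (f ^ˢ toℕ k)) n
  step i = begin
    fromℕ (suc n) * (1/ suc k ! * (f ^ˢ suc k) (suc n))
      ≡⟨ solve 3 (λ x y z → x :* (y :* z) := y :* (x :* z)) refl (fromℕ (suc n)) (1/ suc k !) ((f ^ˢ suc k) (suc n)) ⟩
    1/ suc k ! * D (f ^ˢ suc k) n
      ≡⟨ cong (1/ suc k ! *_) (D-^ f k n) ⟩
    1/ suc k ! * (fromℕ (suc k) * (D f ⊛ (f ^ˢ k)) n)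
      ≡⟨ *-assoc (1/ suc k !) (fromℕ (suc k)) _ ⟨
    1/ suc k ! * fromℕ (suc k) * (D f ⊛ (f ^ˢ k)) n
      ≡⟨ cong (_* (D f ⊛ (f ^ˢ k)) n) (1/suc!-* k) ⟩
    1/ k ! * (D f ⊛ (f ^ˢ k)) n ∎
    where
    k : ℕ
    k = toℕ i

-- The equation at `t^j` determines `y (suc j)` from the coefficients up to `j`. Exponentials are
-- later identified with products by exhibiting the same equation for both.
linearODE-unique : ∀ g {y z} → D y ≗ g ⊛ y → D z ≗ g ⊛ z → y 0 ≡ z 0 → y ≗ z
linearODE-unique g {y} {z} Dy Dz y₀≡z₀ n = upTo n n ℕ.≤-refl
  where
  -- `(g ⊛ y) j` involves every coefficient up to `j`, so the induction has to be strong.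
  upTo : ∀ n j → j ≤ n → y j ≡ z j
  upTo n zero _ = y₀≡z₀
  upTo (suc n) (suc j) (s≤s j≤n) = fromℕ-*-cancelˡ (suc j) (begin
    D y j      ≡⟨ Dy j ⟩
    (g ⊛ y) j  ≡⟨ ⊛-congʳ-≤ g j (λ i i≤j → upTo n i (ℕ.≤-trans i≤j j≤n)) ⟩
    (g ⊛ z) j  ≡⟨ Dz j ⟨
    D z j      ∎)

D-exp[t] : ∀ x n → D exp[ x t] n ≡ x * exp[ x t] n
D-exp[t] x n = begin
  D exp[ x t] n                                          ≡⟨ D-exp (constant x ⊛ indeterminate) (trans (constant-⊛ x indeterminate 0) (*-zeroʳ x)) n ⟩
  (D (constant x ⊛ indeterminate) ⊛ exp[ x t]) n         ≡⟨ ⊛-congˡ exp[ x t] D-xt n ⟩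
  (constant x ⊛ exp[ x t]) n                             ≡⟨ constant-⊛ x exp[ x t] n ⟩
  x * exp[ x t] n                                        ∎
  where
  D-xt : D (constant x ⊛ indeterminate) ≗ constant x
  D-xt zero    = trans (*-identityˡ _) (trans (constant-⊛ x indeterminate 1) (*-identityʳ x))
  D-xt (suc i) = begin
    fromℕ (2 ℕ.+ i) * (constant x ⊛ indeterminate) (2 ℕ.+ i)  ≡⟨ cong (fromℕ (2 ℕ.+ i) *_) (trans (constant-⊛ x indeterminate (2 ℕ.+ i)) (*-zeroʳ x)) ⟩
    fromℕ (2 ℕ.+ i) * 0ℚ                                      ≡⟨ *-zeroʳ (fromℕ (2 ℕ.+ i)) ⟩
    0ℚ                                                        ∎

-- Multiplication by powers of t

sum-drop : ∀ l N (g : ℕ → ℚ) → (∀ k → k < l → g k ≡ 0ℚ) →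
  ∑[ i < N ] g (toℕ i) ≡ ∑[ i < N ∸ l ] g (l ℕ.+ toℕ i)
sum-drop zero    N       g g≡0 = refl
sum-drop (suc l) zero    g g≡0 = refl
sum-drop (suc l) (suc N) g g≡0 = begin
  g 0 + ∑[ i < N ] g (suc (toℕ i))        ≡⟨ cong₂ _+_ (g≡0 0 z<s) (sum-drop l N (λ k → g (suc k)) (λ k k<l → g≡0 (suc k) (s<s k<l))) ⟩
  0ℚ + ∑[ i < N ∸ l ] g (suc (l ℕ.+ toℕ i)) ≡⟨ +-identityˡ _ ⟩
  ∑[ i < N ∸ l ] g (suc (l ℕ.+ toℕ i))      ∎

indeterminate-⊛-zero : ∀ a → (indeterminate ⊛ a) 0 ≡ 0ℚ
indeterminate-⊛-zero a = trans (+-identityʳ _) (*-zeroˡ (a 0))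

indeterminate-⊛-suc : ∀ a n → (indeterminate ⊛ a) (suc n) ≡ a n
indeterminate-⊛-suc a n = begin
  0ℚ * a (suc n) + (divideByT indeterminate ⊛ a) n  ≡⟨ cong₂ _+_ (*-zeroˡ (a (suc n))) (⊛-congˡ {divideByT indeterminate} {constant 1ℚ} a (λ { zero → refl ; (suc _) → refl }) n) ⟩
  0ℚ + (constant 1ℚ ⊛ a) n                          ≡⟨ +-identityˡ _ ⟩
  (constant 1ℚ ⊛ a) n                               ≡⟨ constant-⊛ 1ℚ a n ⟩
  1ℚ * a n                                          ≡⟨ *-identityˡ (a n) ⟩
  a n                                               ∎

indeterminate^-⊛-< : ∀ l a {k} → k < l → ((indeterminate ^ˢ l) ⊛ a) k ≡ 0ℚ
indeterminate^-⊛-< (suc l) a {zero} _ =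
  trans (⊛-assoc indeterminate (indeterminate ^ˢ l) a 0) (indeterminate-⊛-zero ((indeterminate ^ˢ l) ⊛ a))
indeterminate^-⊛-< (suc l) a {suc k} (s<s k<l) =
  trans (⊛-assoc indeterminate (indeterminate ^ˢ l) a (suc k))
    (trans (indeterminate-⊛-suc ((indeterminate ^ˢ l) ⊛ a) k) (indeterminate^-⊛-< l a k<l))

indeterminate^-⊛-+ : ∀ l a i → ((indeterminate ^ˢ l) ⊛ a) (l ℕ.+ i) ≡ a i
indeterminate^-⊛-+ zero a i = trans (constant-⊛ 1ℚ a i) (*-identityˡ (a i))
indeterminate^-⊛-+ (suc l) a i =
  trans (⊛-assoc indeterminate (indeterminate ^ˢ l) a (suc l ℕ.+ i))
    (trans (indeterminate-⊛-suc ((indeterminate ^ˢ l) ⊛ a) (l ℕ.+ i)) (indeterminate^-⊛-+ l a i))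

-- The operators D + c

D+ : ℚ → Series → Series
D+ c a n = D a n + c * a n

D+-cong : ∀ c {a b} → a ≗ b → D+ c a ≗ D+ c b
D+-cong c p n = cong₂ _+_ (D-cong p n) (cong (c *_) (p n))

D+-⊕ : ∀ c a b → D+ c (a ⊕ b) ≗ D+ c a ⊕ D+ c b
D+-⊕ c a b n = solve 6 (λ s c a₀ a₁ b₀ b₁ →
  s :* (a₁ :+ b₁) :+ c :* (a₀ :+ b₀) := (s :* a₁ :+ c :* a₀) :+ (s :* b₁ :+ c :* b₀))
  refl (fromℕ (suc n)) c (a n) (a (suc n)) (b n) (b (suc n))

D+-comm : ∀ c d a → D+ c (D+ d a) ≗ D+ d (D+ c a)
D+-comm c d a n = solve 7 (λ s s′ c d a₀ a₁ a₂ →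
  s :* (s′ :* a₂ :+ d :* a₁) :+ c :* (s :* a₁ :+ d :* a₀) :=
  s :* (s′ :* a₂ :+ c :* a₁) :+ d :* (s :* a₁ :+ c :* a₀))
  refl (fromℕ (suc n)) (fromℕ (2 ℕ.+ n)) c d (a n) (a (suc n)) (a (2 ℕ.+ n))

-- The exponential shift: by the Leibniz rule and `D exp[ x t] = x exp[ x t]`, moving `D` past the
-- exponential adds `x` to the constant.
D+-exp : ∀ c x a → D+ c (exp[ x t] ⊛ a) ≗ exp[ x t] ⊛ D+ (x + c) a
D+-exp c x a n = begin
  D (E ⊛ a) n + c * (E ⊛ a) n
    ≡⟨ cong (_+ c * (E ⊛ a) n) (begin
         D (E ⊛ a) n                        ≡⟨ D-⊛ E a n ⟩
         (D E ⊛ a) n + (E ⊛ D a) n          ≡⟨ cong (_+ (E ⊛ D a) n) (trans (⊛-congˡ a (D-exp[t] x) n) (scale-⊛ x E a n)) ⟩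
         x * (E ⊛ a) n + (E ⊛ D a) n        ∎) ⟩
  x * (E ⊛ a) n + (E ⊛ D a) n + c * (E ⊛ a) n
    ≡⟨ solve 4 (λ x y z c → x :* y :+ z :+ c :* y := z :+ (x :+ c) :* y) refl x ((E ⊛ a) n) ((E ⊛ D a) n) c ⟩
  (E ⊛ D a) n + (x + c) * (E ⊛ a) n
    ≡⟨ cong ((E ⊛ D a) n +_) (⊛-scaleʳ (x + c) E a n) ⟨
  (E ⊛ D a) n + (E ⊛ (λ i → (x + c) * a i)) n
    ≡⟨ ⊛-distribˡ E (D a) (λ i → (x + c) * a i) n ⟨
  (E ⊛ D+ (x + c) a) n ∎
  where
  E : Series
  E = exp[ x t]

-- This is `(D + r)(D + r + 1)⋯(D + r + n - 1)`, the polynomial of `rStirling₁ r n` evaluated at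
-- `D`. Peeling the lowest factor matches `rStirling₁-suc`.
risingD : ℕ → ℕ → Series → Series
risingD r zero    a = a
risingD r (suc n) a = risingD (suc r) n (D+ (fromℕ r) a)

risingD-cong : ∀ r n {a b} → a ≗ b → risingD r n a ≗ risingD r n b
risingD-cong r zero    p = p
risingD-cong r (suc n) p = risingD-cong (suc r) n (D+-cong (fromℕ r) p)

risingD-⊕ : ∀ r n a b → risingD r n (a ⊕ b) ≗ risingD r n a ⊕ risingD r n b
risingD-⊕ r zero    a b i = refl
risingD-⊕ r (suc n) a b i = trans (risingD-cong (suc r) n (D+-⊕ (fromℕ r) a b) i)
  (risingD-⊕ (suc r) n (D+ (fromℕ r) a) (D+ (fromℕ r) b) i)

risingD-exp : ∀ q r n a → risingD r n (exp[ fromℕ q t] ⊛ a) ≗ exp[ fromℕ q t] ⊛ risingD (q ℕ.+ r) n a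
risingD-exp q r zero    a i = refl
risingD-exp q r (suc n) a i = begin
  risingD (suc r) n (D+ (fromℕ r) (E ⊛ a)) i
    ≡⟨ risingD-cong (suc r) n (λ j → trans (D+-exp (fromℕ r) (fromℕ q) a j)
         (cong (λ c → (E ⊛ D+ c a) j) (sym (fromℕ-homo-+ q r)))) i ⟩
  risingD (suc r) n (E ⊛ D+ (fromℕ (q ℕ.+ r)) a) i
    ≡⟨ risingD-exp q (suc r) n (D+ (fromℕ (q ℕ.+ r)) a) i ⟩
  (E ⊛ risingD (q ℕ.+ suc r) n (D+ (fromℕ (q ℕ.+ r)) a)) i
    ≡⟨ cong (λ s → (E ⊛ risingD s n (D+ (fromℕ (q ℕ.+ r)) a)) i) (ℕ.+-suc q r) ⟩
  (E ⊛ risingD (q ℕ.+ r) (suc n) a) i ∎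
  where
  E : Series
  E = exp[ fromℕ q t]

risingD-D+ : ∀ r n c a → risingD r n (D+ c a) ≗ D+ c (risingD r n a)
risingD-D+ r zero    c a i = refl
risingD-D+ r (suc n) c a i = trans (risingD-cong (suc r) n (D+-comm (fromℕ r) c a) i)
  (risingD-D+ (suc r) n c (D+ (fromℕ r) a) i)

-- The definition peels the lowest factor; because the factors commute, the highest can be peeled as
-- well. In `risingD-inverse` the constants `2 + m + n` and `1 + m` of two such factors differ by
-- the multiplier `n + 1`.
risingD-snoc : ∀ r n a → risingD r (suc n) a ≗ D+ (fromℕ (r ℕ.+ n)) (risingD r n a)
risingD-snoc r zero    a i = cong (λ s → D+ (fromℕ s) a i) (sym (ℕ.+-identityʳ r))
risingD-snoc r (suc n) a i = trans (risingD-snoc (suc r) n (D+ (fromℕ r) a) i)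
  (cong (λ s → D+ (fromℕ s) (risingD r (suc n) a) i) (sym (ℕ.+-suc r n)))

-- r-Stirling numbers

rStirling₁-suc : ∀ r n → rStirling₁ r (suc n) ≗ (indeterminate ⊕ constant (fromℕ r)) ⊛ rStirling₁ (suc r) n
rStirling₁-suc r n = ⊛-cong
  {indeterminate ⊕ constant (fromℕ (r ℕ.+ 0))} {indeterminate ⊕ constant (fromℕ r)}
  (λ i → cong (λ s → (indeterminate ⊕ constant (fromℕ s)) i) (ℕ.+-identityʳ r))
  (product-cong {n} (λ j i → cong (λ s → (indeterminate ⊕ constant (fromℕ s)) i) (ℕ.+-suc r (toℕ j))))
  where
  open MonoidSum (CommutativeRing.*-monoid series-commutativeRing) renaming (sum-cong-≋ to product-cong)

linear-⊛ : ∀ c a n → ((indeterminate ⊕ constant c) ⊛ a) n ≡ (indeterminate ⊛ a) n + c * a n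
linear-⊛ c a n = trans (⊛-distribʳ a indeterminate (constant c) n)
  (cong ((indeterminate ⊛ a) n +_) (constant-⊛ c a n))

rStirling₁-suc-zero : ∀ r n → rStirling₁ r (suc n) 0 ≡ fromℕ r * rStirling₁ (suc r) n 0
rStirling₁-suc-zero r n = begin
  rStirling₁ r (suc n) 0                                     ≡⟨ rStirling₁-suc r n 0 ⟩
  ((indeterminate ⊕ constant (fromℕ r)) ⊛ p) 0               ≡⟨ linear-⊛ (fromℕ r) p 0 ⟩
  (indeterminate ⊛ p) 0 + fromℕ r * p 0                      ≡⟨ cong (_+ fromℕ r * p 0) (indeterminate-⊛-zero p) ⟩
  0ℚ + fromℕ r * p 0                                         ≡⟨ +-identityˡ _ ⟩
  fromℕ r * p 0                                              ∎
  where
  p : Series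
  p = rStirling₁ (suc r) n

rStirling₁-suc-suc : ∀ r n k →
  rStirling₁ r (suc n) (suc k) ≡ rStirling₁ (suc r) n k + fromℕ r * rStirling₁ (suc r) n (suc k)
rStirling₁-suc-suc r n k = begin
  rStirling₁ r (suc n) (suc k)                         ≡⟨ rStirling₁-suc r n (suc k) ⟩
  ((indeterminate ⊕ constant (fromℕ r)) ⊛ p) (suc k)   ≡⟨ linear-⊛ (fromℕ r) p (suc k) ⟩
  (indeterminate ⊛ p) (suc k) + fromℕ r * p (suc k)    ≡⟨ cong (_+ fromℕ r * p (suc k)) (indeterminate-⊛-suc p k) ⟩
  p k + fromℕ r * p (suc k)                            ∎
  where
  p : Series
  p = rStirling₁ (suc r) n

rStirling₁-vanishes : ∀ r {n k} → n < k → rStirling₁ r n k ≡ 0ℚ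
rStirling₁-vanishes r {zero}  {suc k} _ = refl
rStirling₁-vanishes r {suc n} {suc k} (s<s n<k) = begin
  rStirling₁ r (suc n) (suc k)        ≡⟨ rStirling₁-suc-suc r n k ⟩
  p k + fromℕ r * p (suc k)           ≡⟨ cong₂ (λ x y → x + fromℕ r * y) (rStirling₁-vanishes (suc r) n<k) (rStirling₁-vanishes (suc r) (ℕ.m<n⇒m<1+n n<k)) ⟩
  0ℚ + fromℕ r * 0ℚ                   ≡⟨ trans (+-identityˡ _) (*-zeroʳ (fromℕ r)) ⟩
  0ℚ                                  ∎
  where
  p : Series
  p = rStirling₁ (suc r) n

-- The constant term of `D^k a` is `k! a_k`. In the induction `b k = k! a_k` absorbs the weight of
-- `D`, so `D` merely shifts `b` by one, which is multiplication by `x` on the polynomial side. The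
-- free bound `K` lets callers keep terms beyond `n`.
risingD-zero : ∀ r n {K} → n ≤ K → ∀ a →
  risingD r n a 0 ≡ ∑[ k ≤ K ] (rStirling₁ r n (toℕ k) * (fromℕ (toℕ k !) * a (toℕ k)))
risingD-zero r zero {K} _ a = sym (begin
  1ℚ * (1ℚ * a 0) + ∑[ k < K ] (0ℚ * (fromℕ (suc (toℕ k) !) * a (suc (toℕ k))))
    ≡⟨ cong (1ℚ * (1ℚ * a 0) +_) (sum-zero K (λ k → *-zeroˡ (fromℕ (suc (toℕ k) !) * a (suc (toℕ k))))) ⟩
  1ℚ * (1ℚ * a 0) + 0ℚ
    ≡⟨ solve 1 (λ x → con 1ℚ :* (con 1ℚ :* x) :+ con 0ℚ := x) refl (a 0) ⟩
  a 0 ∎)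
risingD-zero r (suc n) {suc K} (s≤s n≤K) a = begin
  risingD (suc r) n (D+ (fromℕ r) a) 0
    ≡⟨ risingD-zero (suc r) n n≤K (D+ (fromℕ r) a) ⟩
  ∑[ k ≤ K ] (p (toℕ k) * (fromℕ (toℕ k !) * D+ (fromℕ r) a (toℕ k)))
    ≡⟨ sum-cong-≗ {suc K} (λ k → split (toℕ k)) ⟩
  ∑[ k ≤ K ] (p (toℕ k) * b (suc (toℕ k)) + fromℕ r * (p (toℕ k) * b (toℕ k)))
    ≡⟨ ∑-distrib-+ {suc K} (λ k → p (toℕ k) * b (suc (toℕ k))) (λ k → fromℕ r * (p (toℕ k) * b (toℕ k))) ⟩
  S + ∑[ k ≤ K ] (fromℕ r * (p (toℕ k) * b (toℕ k)))
    -- One vanishing term is added at `k = K + 1`, so that splitting off `k = 0` leaves a sum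
    -- aligned with the shifted sum `S`.
    ≡⟨ cong (S +_) (sum-extend (λ k → fromℕ r * (p k * b k)) (ℕ.n≤1+n (suc K)) beyond) ⟩
  S + (fromℕ r * (p 0 * b 0) + ∑[ k ≤ K ] (fromℕ r * (p (suc (toℕ k)) * b (suc (toℕ k)))))
    ≡⟨ solve 3 (λ x y z → x :+ (y :+ z) := y :+ (x :+ z)) refl S (fromℕ r * (p 0 * b 0)) _ ⟩
  fromℕ r * (p 0 * b 0) + (S + ∑[ k ≤ K ] (fromℕ r * (p (suc (toℕ k)) * b (suc (toℕ k)))))
    ≡⟨ cong (fromℕ r * (p 0 * b 0) +_) (∑-distrib-+ {suc K} (λ k → p (toℕ k) * b (suc (toℕ k))) (λ k → fromℕ r * (p (suc (toℕ k)) * b (suc (toℕ k))))) ⟨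
  fromℕ r * (p 0 * b 0) + ∑[ k ≤ K ] (p (toℕ k) * b (suc (toℕ k)) + fromℕ r * (p (suc (toℕ k)) * b (suc (toℕ k))))
    ≡⟨ cong₂ _+_ (trans (sym (*-assoc (fromℕ r) (p 0) (b 0))) (cong (_* b 0) (sym (rStirling₁-suc-zero r n))))
         (sum-cong-≗ {suc K} (λ k → merge (toℕ k))) ⟩
  ∑[ k ≤ suc K ] (rStirling₁ r (suc n) (toℕ k) * b (toℕ k)) ∎
  where
  p b : Series
  p = rStirling₁ (suc r) n
  b k = fromℕ (k !) * a k

  S : ℚ
  S = ∑[ k ≤ K ] (p (toℕ k) * b (suc (toℕ k)))

  split : ∀ k → p k * (fromℕ (k !) * D+ (fromℕ r) a k) ≡ p k * b (suc k) + fromℕ r * (p k * b k)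
  split k = begin
    p k * (fromℕ (k !) * (fromℕ (suc k) * a (suc k) + fromℕ r * a k))
      ≡⟨ solve 6 (λ x y z a₁ r a₀ → x :* (y :* (z :* a₁ :+ r :* a₀)) := x :* (z :* y :* a₁) :+ r :* (x :* (y :* a₀))) refl
           (p k) (fromℕ (k !)) (fromℕ (suc k)) (a (suc k)) (fromℕ r) (a k) ⟩
    p k * (fromℕ (suc k) * fromℕ (k !) * a (suc k)) + fromℕ r * (p k * b k)
      ≡⟨ cong (λ x → p k * (x * a (suc k)) + fromℕ r * (p k * b k)) (fromℕ-homo-* (suc k) (k !)) ⟨
    p k * b (suc k) + fromℕ r * (p k * b k) ∎

  beyond : ∀ k → suc K ≤ k → fromℕ r * (p k * b k) ≡ 0ℚ
  beyond k K<k = begin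
    fromℕ r * (p k * b k)  ≡⟨ cong (λ x → fromℕ r * (x * b k)) (rStirling₁-vanishes (suc r) (ℕ.≤-<-trans n≤K K<k)) ⟩
    fromℕ r * (0ℚ * b k)   ≡⟨ cong (fromℕ r *_) (*-zeroˡ (b k)) ⟩
    fromℕ r * 0ℚ           ≡⟨ *-zeroʳ (fromℕ r) ⟩
    0ℚ                     ∎

  merge : ∀ k → p k * b (suc k) + fromℕ r * (p (suc k) * b (suc k)) ≡ rStirling₁ r (suc n) (suc k) * b (suc k)
  merge k = trans
    (solve 4 (λ x y r z → x :* y :+ r :* (z :* y) := (x :+ r :* z) :* y) refl (p k) (b (suc k)) (fromℕ r) (p (suc k)))
    (cong (_* b (suc k)) (sym (rStirling₁-suc-suc r n k)))

risingD-zero-indeterminate^ : ∀ r n {K} → n ≤ K → ∀ l a →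
  risingD r n ((indeterminate ^ˢ l) ⊛ a) 0
    ≡ ∑[ i < suc K ∸ l ] (rStirling₁ r n (l ℕ.+ toℕ i) * (fromℕ ((l ℕ.+ toℕ i) !) * a (toℕ i)))
risingD-zero-indeterminate^ r n {K} n≤K l a = begin
  risingD r n (tˡ ⊛ a) 0
    ≡⟨ risingD-zero r n n≤K (tˡ ⊛ a) ⟩
  ∑[ k ≤ K ] g (toℕ k)
    ≡⟨ sum-drop l (suc K) g (λ k k<l → begin
         p k * (fromℕ (k !) * (tˡ ⊛ a) k)  ≡⟨ cong (λ x → p k * (fromℕ (k !) * x)) (indeterminate^-⊛-< l a k<l) ⟩
         p k * (fromℕ (k !) * 0ℚ)          ≡⟨ cong (p k *_) (*-zeroʳ (fromℕ (k !))) ⟩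
         p k * 0ℚ                          ≡⟨ *-zeroʳ (p k) ⟩
         0ℚ                                ∎) ⟩
  ∑[ i < suc K ∸ l ] g (l ℕ.+ toℕ i)
    ≡⟨ sum-cong-≗ {suc K ∸ l} (λ i → cong (λ x → p (l ℕ.+ toℕ i) * (fromℕ ((l ℕ.+ toℕ i) !) * x)) (indeterminate^-⊛-+ l a (toℕ i))) ⟩
  ∑[ i < suc K ∸ l ] (p (l ℕ.+ toℕ i) * (fromℕ ((l ℕ.+ toℕ i) !) * a (toℕ i))) ∎
  where
  p tˡ g : Series
  p = rStirling₁ r n
  tˡ = indeterminate ^ˢ l
  g k = p k * (fromℕ (k !) * (tˡ ⊛ a) k)

risingD-monomial : ∀ r n s → risingD r n ((indeterminate ^ˢ s) ⊛ constant 1ℚ) 0 ≡ fromℕ (s !) * rStirling₁ r n s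
risingD-monomial r n s = begin
  risingD r n ((indeterminate ^ˢ s) ⊛ constant 1ℚ) 0
    -- The bound `s + n` is at least `n`, as required, and at least `s`, so the only surviving term
    -- `k = s` is in range even when `s > n`.
    ≡⟨ risingD-zero-indeterminate^ r n (ℕ.m≤n+m n s) s (constant 1ℚ) ⟩
  ∑[ i < suc (s ℕ.+ n) ∸ s ] h (toℕ i)
    ≡⟨ cong (λ N → ∑[ i < N ] h (toℕ i)) (trans (cong (_∸ s) (sym (ℕ.+-suc s n))) (ℕ.m+n∸m≡n s (suc n))) ⟩
  h 0 + ∑[ i < n ] h (suc (toℕ i))
    ≡⟨ cong (h 0 +_) (sum-zero n (λ i → trans (cong (p (s ℕ.+ suc (toℕ i)) *_) (*-zeroʳ (fromℕ ((s ℕ.+ suc (toℕ i)) !)))) (*-zeroʳ (p (s ℕ.+ suc (toℕ i)))))) ⟩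
  h 0 + 0ℚ
    ≡⟨ cong (λ k → p k * (fromℕ (k !) * 1ℚ) + 0ℚ) (ℕ.+-identityʳ s) ⟩
  p s * (fromℕ (s !) * 1ℚ) + 0ℚ
    ≡⟨ solve 2 (λ x y → x :* (y :* con 1ℚ) :+ con 0ℚ := y :* x) refl (p s) (fromℕ (s !)) ⟩
  fromℕ (s !) * p s ∎
  where
  p h : Series
  p = rStirling₁ r n
  h i = p (s ℕ.+ i) * (fromℕ ((s ℕ.+ i) !) * constant 1ℚ i)

-- Bernoulli polynomials

[l+i]Pl*i!≡[l+i]! : ∀ l i → ((l ℕ.+ i) P l) ℕ.* i ! ≡ (l ℕ.+ i) !
[l+i]Pl*i!≡[l+i]! l i = begin
  ((l ℕ.+ i) P l) ℕ.* i !                  ≡⟨ cong (λ k → ((l ℕ.+ i) P l) ℕ.* k !) (ℕ.m+n∸m≡n l i) ⟨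
  ((l ℕ.+ i) P l) ℕ.* (l ℕ.+ i ∸ l) !      ≡⟨ cong (ℕ._* (l ℕ.+ i ∸ l) !) (nPk≡n!/[n∸k]! (ℕ.m≤m+n l i)) ⟩
  ((l ℕ.+ i) ! ℕ./ (l ℕ.+ i ∸ l) !) ℕ.* (l ℕ.+ i ∸ l) ! ≡⟨ ℕ.m/n*n≡m (m≤n⇒m!∣n! (ℕ.m∸n≤m (l ℕ.+ i) l)) ⟩
  (l ℕ.+ i) !                              ∎
  where instance _ = (l ℕ.+ i ∸ l) ℕ.!≢0

[e^t-1]/t : Series
[e^t-1]/t = divideByT (exp[ 1ℚ t] ⊖ constant 1ℚ)

-- With `k = l + i`, the factor `k P l` completes the `i!` in `bernoulli i` to `k!`. The sum is then
-- the constant term of an operator applied to `t^l e^{qt} G`, and moving `e^{qt}` to the front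
-- replaces `r` by `q + r`.
sum-bernoulli : ∀ q r n l →
  sumFromTo l n (λ k → rStirling₁ r n k * fromℕ (k P l) * bernoulli (k ∸ l) (fromℕ q))
    ≡ risingD (q ℕ.+ r) n ((indeterminate ^ˢ l) ⊛ inverse [e^t-1]/t) 0
sum-bernoulli q r n l = begin
  ∑[ i < suc n ∸ l ] (rStirling₁ r n (l ℕ.+ toℕ i) * fromℕ ((l ℕ.+ toℕ i) P l) * bernoulli (l ℕ.+ toℕ i ∸ l) (fromℕ q))
    ≡⟨ sum-cong-≗ {suc n ∸ l} (λ i → term (toℕ i)) ⟩
  ∑[ i < suc n ∸ l ] (rStirling₁ r n (l ℕ.+ toℕ i) * (fromℕ ((l ℕ.+ toℕ i) !) * (E ⊛ G) (toℕ i)))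
    ≡⟨ risingD-zero-indeterminate^ r n ℕ.≤-refl l (E ⊛ G) ⟨
  risingD r n (tˡ ⊛ (E ⊛ G)) 0
    ≡⟨ risingD-cong r n (x∙yz≈y∙xz tˡ E G) 0 ⟩
  risingD r n (E ⊛ (tˡ ⊛ G)) 0
    ≡⟨ risingD-exp q r n (tˡ ⊛ G) 0 ⟩
  -- Here `1ℚ` is the constant term of `e^{qt}`, and `0ℚ` the empty rest of the convolution at index
  -- 0.
  1ℚ * risingD (q ℕ.+ r) n (tˡ ⊛ G) 0 + 0ℚ
    ≡⟨ trans (+-identityʳ _) (*-identityˡ _) ⟩
  risingD (q ℕ.+ r) n (tˡ ⊛ G) 0 ∎
  where
  open CommutativeSemigroupProperties (CommutativeRing.*-commutativeSemigroup series-commutativeRing)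
    using (x∙yz≈y∙xz)

  E G tˡ : Series
  E = exp[ fromℕ q t]
  G = inverse [e^t-1]/t
  tˡ = indeterminate ^ˢ l

  term : ∀ i → rStirling₁ r n (l ℕ.+ i) * fromℕ ((l ℕ.+ i) P l) * bernoulli (l ℕ.+ i ∸ l) (fromℕ q)
             ≡ rStirling₁ r n (l ℕ.+ i) * (fromℕ ((l ℕ.+ i) !) * (E ⊛ G) i)
  term i = begin
    s * fromℕ ((l ℕ.+ i) P l) * bernoulli (l ℕ.+ i ∸ l) (fromℕ q)
      ≡⟨ cong (λ k → s * fromℕ ((l ℕ.+ i) P l) * bernoulli k (fromℕ q)) (ℕ.m+n∸m≡n l i) ⟩
    s * fromℕ ((l ℕ.+ i) P l) * (fromℕ (i !) * (E ⊛ G) i)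
      ≡⟨ solve 4 (λ x y z w → x :* y :* (z :* w) := x :* (y :* z :* w)) refl s (fromℕ ((l ℕ.+ i) P l)) (fromℕ (i !)) ((E ⊛ G) i) ⟩
    s * (fromℕ ((l ℕ.+ i) P l) * fromℕ (i !) * (E ⊛ G) i)
      ≡⟨ cong (λ x → s * (x * (E ⊛ G) i)) (trans (sym (fromℕ-homo-* ((l ℕ.+ i) P l) (i !))) (cong fromℕ ([l+i]Pl*i!≡[l+i]! l i))) ⟩
    s * (fromℕ ((l ℕ.+ i) !) * (E ⊛ G) i) ∎
    where
    s : ℚ
    s = rStirling₁ r n (l ℕ.+ i)

-- With `H = (e^t - 1) / t` and `G = 1 / H`, substitute `e^t = t H + 1` and cancel `H G = 1`.
exp-⊛-inverse : ∀ l → let W = (indeterminate ^ˢ l) ⊛ inverse [e^t-1]/t in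
  exp[ 1ℚ t] ⊛ W ≗ ((indeterminate ^ˢ suc l) ⊛ constant 1ℚ) ⊕ W
exp-⊛-inverse l n = begin
  (exp[ 1ℚ t] ⊛ W) n
    ≡⟨ ⊛-congˡ W exp≗ n ⟩
  (((indeterminate ⊛ H) ⊕ constant 1ℚ) ⊛ W) n
    ≡⟨ ⊛-distribʳ W (indeterminate ⊛ H) (constant 1ℚ) n ⟩
  ((indeterminate ⊛ H) ⊛ (tˡ ⊛ G)) n + (constant 1ℚ ⊛ W) n
    ≡⟨ cong₂ _+_ (interchange indeterminate H tˡ G n) (trans (constant-⊛ 1ℚ W n) (*-identityˡ (W n))) ⟩
  ((indeterminate ⊛ tˡ) ⊛ (H ⊛ G)) n + W n
    ≡⟨ cong (_+ W n) (⊛-congʳ (indeterminate ⊛ tˡ) (⊛-inverseʳ {H} refl) n) ⟩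
  ((indeterminate ⊛ tˡ) ⊛ constant 1ℚ) n + W n ∎
  where
  open CommutativeSemigroupProperties (CommutativeRing.*-commutativeSemigroup series-commutativeRing)
    using (interchange)

  H G tˡ W : Series
  H = [e^t-1]/t
  G = inverse H
  tˡ = indeterminate ^ˢ l
  W = tˡ ⊛ G

  exp≗ : exp[ 1ℚ t] ≗ (indeterminate ⊛ H) ⊕ constant 1ℚ
  exp≗ zero    = refl
  exp≗ (suc i) = begin
    exp[ 1ℚ t] (suc i)                   ≡⟨ trans (+-identityʳ _) (+-identityʳ _) ⟨
    exp[ 1ℚ t] (suc i) - 0ℚ + 0ℚ         ≡⟨ cong (_+ 0ℚ) (indeterminate-⊛-suc H i) ⟨
    (indeterminate ⊛ H) (suc i) + 0ℚ     ∎

-- With Z = risingD (2 + m) n W, applying risingD (1 + m) (1 + n) to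
-- e^t W = t^{l+1} + W gives (D + 2 + m + n) Z on the left and (D + 1 + m) Z
-- for the last summand.
risingD-inverse : ∀ m n l →
  fromℕ (suc n) * risingD (2 ℕ.+ m) n ((indeterminate ^ˢ l) ⊛ inverse [e^t-1]/t) 0
    ≡ fromℕ (suc l !) * rStirling₁ (suc m) (suc n) (suc l)
risingD-inverse m n l = begin
  fromℕ (suc n) * Z 0
    ≡⟨ solve 4 (λ d x s z → s :* z := (d :+ (x :+ s) :* z) :- (d :+ x :* z)) refl (D Z 0) (fromℕ (suc m)) (fromℕ (suc n)) (Z 0) ⟩
  (D Z 0 + (fromℕ (suc m) + fromℕ (suc n)) * Z 0) - D+ (fromℕ (suc m)) Z 0
    ≡⟨ cong₂ (λ x y → (D Z 0 + x * Z 0) - y) (fromℕ-homo-+ (suc m) (suc n)) (risingD-D+ (2 ℕ.+ m) n (fromℕ (suc m)) W 0) ⟨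
  D+ (fromℕ (suc m ℕ.+ suc n)) Z 0 - R W 0
    ≡⟨ cong (_- R W 0) (begin
         D+ (fromℕ (suc m ℕ.+ suc n)) Z 0   ≡⟨ cong (λ k → D+ (fromℕ k) Z 0) (ℕ.+-suc (suc m) n) ⟩
         D+ (fromℕ (2 ℕ.+ m ℕ.+ n)) Z 0     ≡⟨ risingD-snoc (2 ℕ.+ m) n W 0 ⟨
         risingD (2 ℕ.+ m) (suc n) W 0      ≡⟨ trans (+-identityʳ _) (*-identityˡ _) ⟨
         (exp[ 1ℚ t] ⊛ risingD (2 ℕ.+ m) (suc n) W) 0 ≡⟨ risingD-exp 1 (suc m) (suc n) W 0 ⟨
         R (exp[ 1ℚ t] ⊛ W) 0               ≡⟨ risingD-cong (suc m) (suc n) (exp-⊛-inverse l) 0 ⟩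
         R (tˡ⁺¹ ⊕ W) 0                     ≡⟨ risingD-⊕ (suc m) (suc n) tˡ⁺¹ W 0 ⟩
         R tˡ⁺¹ 0 + R W 0                   ∎) ⟩
  R tˡ⁺¹ 0 + R W 0 - R W 0
    ≡⟨ solve 2 (λ x y → x :+ y :- y := x) refl (R tˡ⁺¹ 0) (R W 0) ⟩
  R tˡ⁺¹ 0
    ≡⟨ risingD-monomial (suc m) (suc n) (suc l) ⟩
  fromℕ (suc l !) * rStirling₁ (suc m) (suc n) (suc l) ∎
  where
  R : Series → Series
  R = risingD (suc m) (suc n)

  W Z tˡ⁺¹ : Series
  W = (indeterminate ^ˢ l) ⊛ inverse [e^t-1]/t
  Z = risingD (2 ℕ.+ m) n W
  tˡ⁺¹ = (indeterminate ^ˢ suc l) ⊛ constant 1ℚ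

-- Harmonic numbers and Bell polynomials

-- As `(j - 1)! / j! = 1 / j`, this is `- Σ_{j≥1} x_j t^j / j`, which is `log ∏ (1 - a_i t)` when
-- the `x_j` are the power sums of the `a_i`. It is spelled as in `bellP`, so that `harmonicP`
-- unfolds to it.
logSeries : (ℕ → ℚ) → Series
logSeries x = egfFrom1 (λ j → - (fromℕ ((j ∸ 1) !) * x j))

D-logSeries : ∀ x → D (logSeries x) ≗ (λ j → - x (suc j))
D-logSeries x j = begin
  fromℕ (suc j) * (- (fromℕ (j !) * x (suc j)) * 1/ suc j !)
    ≡⟨ solve 4 (λ s f x i → s :* (:- (f :* x) :* i) := i :* (s :* f) :* (:- x)) refl (fromℕ (suc j)) (fromℕ (j !)) (x (suc j)) (1/ suc j !) ⟩
  1/ suc j ! * (fromℕ (suc j) * fromℕ (j !)) * - x (suc j)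
    ≡⟨ cong (_* - x (suc j)) (trans (cong (1/ suc j ! *_) (sym (fromℕ-homo-* (suc j) (j !)))) (1/n*n≡1 (suc j !) {{suc j ℕ.!≢0}})) ⟩
  1ℚ * - x (suc j)
    ≡⟨ *-identityˡ _ ⟩
  - x (suc j) ∎

D-exp-logSeries : ∀ x → D (exp (logSeries x)) ≗ (λ j → - x (suc j)) ⊛ exp (logSeries x)
D-exp-logSeries x n = trans (D-exp (logSeries x) refl n) (⊛-congˡ (exp (logSeries x)) (D-logSeries x) n)

exp-logSeries-zero : ∀ x → (∀ j → x (suc j) ≡ 0ℚ) → exp (logSeries x) ≗ constant 1ℚ
exp-logSeries-zero x x≡0 = linearODE-unique (λ j → - x (suc j)) (D-exp-logSeries x)
  (λ n → trans (D-constant 1ℚ n) (sym (⊛-zeroˡ (λ j → cong -_ (x≡0 j)) (constant 1ℚ) n))) refl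

-- The name reads `1 - a t`. Its tail is definitionally `constant (- a)`, so products with it reduce
-- to `constant-⊛`.
1-at : ℚ → Series
1-at a zero    = 1ℚ
1-at a (suc n) = constant (- a) n

D-1-at : ∀ a → D (1-at a) ≗ constant (- a)
D-1-at a zero    = *-identityˡ (- a)
D-1-at a (suc n) = *-zeroʳ (fromℕ (2 ℕ.+ n))

1-at-⊛-suc : ∀ a b n → (1-at a ⊛ b) (suc n) ≡ b (suc n) + - a * b n
1-at-⊛-suc a b n = cong₂ _+_ (*-identityˡ (b (suc n))) (constant-⊛ (- a) b n)

-- This identifies the logarithmic derivative of `1 - a t` as `- Σ_j a^{j+1} t^j`.
1-at-⊛-geometric : ∀ a → 1-at a ⊛ (λ j → - (a ^ suc j)) ≗ constant (- a)
1-at-⊛-geometric a zero = solve 1 (λ a → con 1ℚ :* (:- (a :* con 1ℚ)) :+ con 0ℚ := :- a) refl a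
1-at-⊛-geometric a (suc n) = trans (1-at-⊛-suc a (λ j → - (a ^ suc j)) n)
  (solve 2 (λ a p → :- (a :* (a :* p)) :+ (:- a) :* (:- (a :* p)) := con 0ℚ) refl a (a ^ n))

-- Adding a^j to every power sum x_j multiplies exp (- Σ_j x_j t^j / j) = ∏ (1 - a_i t)
-- by one more factor.
exp-logSeries-+ : ∀ x y a → (∀ j → x (suc j) ≡ y (suc j) + a ^ suc j) →
  exp (logSeries x) ≗ 1-at a ⊛ exp (logSeries y)
exp-logSeries-+ x y a x≡y+a^ = linearODE-unique gˣ (D-exp-logSeries x) ode refl
  where
  open CommutativeSemigroupProperties (CommutativeRing.*-commutativeSemigroup series-commutativeRing)
    using (x∙yz≈y∙xz)

  L E gˣ gʸ h : Series
  L = 1-at a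
  E = exp (logSeries y)
  gˣ j = - x (suc j)
  gʸ j = - y (suc j)
  h j = - (a ^ suc j)

  ode : D (L ⊛ E) ≗ gˣ ⊛ (L ⊛ E)
  ode n = begin
    D (L ⊛ E) n
      ≡⟨ D-⊛ L E n ⟩
    (D L ⊛ E) n + (L ⊛ D E) n
      ≡⟨ cong₂ _+_ (⊛-congˡ E (λ i → trans (D-1-at a i) (sym (1-at-⊛-geometric a i))) n) (⊛-congʳ L (D-exp-logSeries y) n) ⟩
    ((L ⊛ h) ⊛ E) n + (L ⊛ (gʸ ⊛ E)) n
      ≡⟨ cong₂ _+_ (trans (⊛-assoc L h E n) (x∙yz≈y∙xz L h E n)) (x∙yz≈y∙xz L gʸ E n) ⟩
    (h ⊛ (L ⊛ E)) n + (gʸ ⊛ (L ⊛ E)) n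
      ≡⟨ ⊛-distribʳ (L ⊛ E) h gʸ n ⟨
    ((h ⊕ gʸ) ⊛ (L ⊛ E)) n
      ≡⟨ ⊛-congˡ (L ⊛ E) (λ j → trans (solve 2 (λ u v → (:- u) :+ (:- v) := :- (v :+ u)) refl (a ^ suc j) (y (suc j))) (cong -_ (sym (x≡y+a^ j)))) n ⟩
    (gˣ ⊛ (L ⊛ E)) n ∎

1/n^j : ∀ n .{{_ : ℕ.NonZero n}} j → (ℤ.+ 1 / n) ^ j ≡ (ℤ.+ 1 / (n ℕ.^ j)) {{ℕ.m^n≢0 n j}}
1/n^j n j = 1/n-unique (n ℕ.^ j) {{ℕ.m^n≢0 n j}} (go j)
  where
  a : ℚ
  a = ℤ.+ 1 / n

  go : ∀ j → a ^ j * fromℕ (n ℕ.^ j) ≡ 1ℚ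
  go zero    = refl
  go (suc j) = begin
    a * a ^ j * fromℕ (n ℕ.* n ℕ.^ j)          ≡⟨ cong (a * a ^ j *_) (fromℕ-homo-* n (n ℕ.^ j)) ⟩
    a * a ^ j * (fromℕ n * fromℕ (n ℕ.^ j))    ≡⟨ solve 4 (λ x y z w → x :* y :* (z :* w) := x :* z :* (y :* w)) refl a (a ^ j) (fromℕ n) (fromℕ (n ℕ.^ j)) ⟩
    a * fromℕ n * (a ^ j * fromℕ (n ℕ.^ j))    ≡⟨ cong₂ _*_ (1/n*n≡1 n) (go j) ⟩
    1ℚ                                         ∎

harmonic-suc : ∀ j m → harmonic j (suc m) ≡ harmonic j m + (ℤ.+ 1 / suc m) ^ j
harmonic-suc j m = begin
  harmonic j (suc m)
    ≡⟨ sum-init-last {m} (λ i → g (toℕ i)) ⟩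
  ∑[ i < m ] g (toℕ (Fin.inject₁ i)) + g (toℕ (Fin.fromℕ m))
    ≡⟨ cong₂ _+_ (sum-cong-≗ {m} (λ i → cong g (toℕ-inject₁ i))) (trans (cong g (toℕ-fromℕ m)) (sym (1/n^j (suc m) j))) ⟩
  harmonic j m + (ℤ.+ 1 / suc m) ^ j ∎
  where
  g : ℕ → ℚ
  g i = (ℤ.+ 1 / (suc i ℕ.^ j)) {{ℕ.m^n≢0 (suc i) j}}

harmonicExp : ℕ → ℕ → Series
harmonicExp N m = exp (logSeries (λ j → harmonic j N - harmonic j m))

-- Factoring the constants out of `(x + m + 1)⋯(x + m + n)` leaves `(m + n)! / m!` times
-- `∏ (1 + x / i)`. `harmonicExp` is `∏ (1 - t / i)`, so the sign comes from `t = - x`. The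
-- induction peels `i = m + 1` and keeps the upper end fixed.
rStirling₁-harmonicExp : ∀ m n s →
  fromℕ (m !) * rStirling₁ (suc m) n s ≡ (- 1ℚ) ^ s * (fromℕ ((m ℕ.+ n) !) * harmonicExp (m ℕ.+ n) m s)
rStirling₁-harmonicExp m zero s = begin
  fromℕ (m !) * constant 1ℚ s
    ≡⟨ sign s ⟩
  (- 1ℚ) ^ s * (fromℕ (m !) * constant 1ℚ s)
    ≡⟨ cong (λ z → (- 1ℚ) ^ s * (fromℕ (m !) * z)) (exp-logSeries-zero (λ j → harmonic j m - harmonic j m) (λ j → +-inverseʳ (harmonic (suc j) m)) s) ⟨
  (- 1ℚ) ^ s * (fromℕ (m !) * harmonicExp m m s)
    ≡⟨ cong (λ N → (- 1ℚ) ^ s * (fromℕ (N !) * harmonicExp N m s)) (ℕ.+-identityʳ m) ⟨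
  (- 1ℚ) ^ s * (fromℕ ((m ℕ.+ 0) !) * harmonicExp (m ℕ.+ 0) m s) ∎
  where
  sign : ∀ s → fromℕ (m !) * constant 1ℚ s ≡ (- 1ℚ) ^ s * (fromℕ (m !) * constant 1ℚ s)
  sign zero    = sym (*-identityˡ _)
  sign (suc s) = solve 2 (λ x y → x :* con 0ℚ := y :* (x :* con 0ℚ)) refl (fromℕ (m !)) ((- 1ℚ) ^ suc s)
rStirling₁-harmonicExp m (suc n) s = begin
  fromℕ (m !) * rStirling₁ (suc m) (suc n) s
    ≡⟨ step s ⟩
  (- 1ℚ) ^ s * (fromℕ (N !) * harmonicExp N m s)
    ≡⟨ cong (λ N → (- 1ℚ) ^ s * (fromℕ (N !) * harmonicExp N m s)) (ℕ.+-suc m n) ⟨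
  (- 1ℚ) ^ s * (fromℕ ((m ℕ.+ suc n) !) * harmonicExp (m ℕ.+ suc n) m s) ∎
  where
  N : ℕ
  -- In this form the induction hypothesis at `suc m` and `n` has the same upper end by definition.
  N = suc m ℕ.+ n

  a : ℚ
  a = ℤ.+ 1 / suc m

  p E : Series
  p = rStirling₁ (2 ℕ.+ m) n
  E = harmonicExp N (suc m)

  harmonicExp-suc : harmonicExp N m ≗ 1-at a ⊛ E
  harmonicExp-suc = exp-logSeries-+ (λ j → harmonic j N - harmonic j m) (λ j → harmonic j N - harmonic j (suc m)) a
    (λ j → sym (begin
      harmonic (suc j) N - harmonic (suc j) (suc m) + a ^ suc j
        ≡⟨ cong (λ z → harmonic (suc j) N - z + a ^ suc j) (harmonic-suc (suc j) m) ⟩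
      harmonic (suc j) N - (harmonic (suc j) m + a ^ suc j) + a ^ suc j
        ≡⟨ solve 3 (λ x y z → x :+ (:- (y :+ z)) :+ z := x :+ (:- y)) refl (harmonic (suc j) N) (harmonic (suc j) m) (a ^ suc j) ⟩
      harmonic (suc j) N - harmonic (suc j) m ∎))

  IH : ∀ s → fromℕ (suc m !) * p s ≡ (- 1ℚ) ^ s * (fromℕ (N !) * E s)
  IH = rStirling₁-harmonicExp (suc m) n

  m!≡a*[1+m]! : fromℕ (m !) ≡ a * fromℕ (suc m !)
  m!≡a*[1+m]! = sym (begin
    a * fromℕ (suc m !)                 ≡⟨ cong (a *_) (fromℕ-homo-* (suc m) (m !)) ⟩
    a * (fromℕ (suc m) * fromℕ (m !))   ≡⟨ *-assoc a (fromℕ (suc m)) (fromℕ (m !)) ⟨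
    a * fromℕ (suc m) * fromℕ (m !)     ≡⟨ cong (_* fromℕ (m !)) (1/n*n≡1 (suc m)) ⟩
    1ℚ * fromℕ (m !)                    ≡⟨ *-identityˡ _ ⟩
    fromℕ (m !)                         ∎)

  m!*[1+m] : ∀ z → fromℕ (m !) * (fromℕ (suc m) * z) ≡ fromℕ (suc m !) * z
  m!*[1+m] z = trans (solve 3 (λ x y z → x :* (y :* z) := y :* x :* z) refl (fromℕ (m !)) (fromℕ (suc m)) z)
    (cong (_* z) (sym (fromℕ-homo-* (suc m) (m !))))

  step : ∀ s → fromℕ (m !) * rStirling₁ (suc m) (suc n) s ≡ (- 1ℚ) ^ s * (fromℕ (N !) * harmonicExp N m s)
  step zero = begin
    fromℕ (m !) * rStirling₁ (suc m) (suc n) 0   ≡⟨ cong (fromℕ (m !) *_) (rStirling₁-suc-zero (suc m) n) ⟩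
    fromℕ (m !) * (fromℕ (suc m) * p 0)          ≡⟨ m!*[1+m] (p 0) ⟩
    -- Both `E` and `harmonicExp N m` have constant term `1ℚ` by computation.
    fromℕ (suc m !) * p 0                        ≡⟨ IH 0 ⟩
    (- 1ℚ) ^ 0 * (fromℕ (N !) * 1ℚ)              ∎
  step (suc s) = begin
    fromℕ (m !) * rStirling₁ (suc m) (suc n) (suc s)
      ≡⟨ cong (fromℕ (m !) *_) (rStirling₁-suc-suc (suc m) n s) ⟩
    fromℕ (m !) * (p s + fromℕ (suc m) * p (suc s))
      ≡⟨ *-distribˡ-+ (fromℕ (m !)) (p s) _ ⟩
    fromℕ (m !) * p s + fromℕ (m !) * (fromℕ (suc m) * p (suc s))
      -- Both summands are brought to the factor `(m + 1)!` of the induction hypothesis.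
      ≡⟨ cong₂ _+_ (trans (cong (_* p s) m!≡a*[1+m]!) (*-assoc a _ (p s))) (m!*[1+m] (p (suc s))) ⟩
    a * (fromℕ (suc m !) * p s) + fromℕ (suc m !) * p (suc s)
      ≡⟨ cong₂ (λ x y → a * x + y) (IH s) (IH (suc s)) ⟩
    a * ((- 1ℚ) ^ s * (fromℕ (N !) * E s)) + - 1ℚ * (- 1ℚ) ^ s * (fromℕ (N !) * E (suc s))
      -- Pulling out `(- 1ℚ) ^ suc s` flips the sign of the lower term, which produces the
      -- coefficient `- a` of `1-at a`.
      ≡⟨ solve 5 (λ a g f e e′ → a :* (g :* (f :* e)) :+ con (- 1ℚ) :* g :* (f :* e′) := con (- 1ℚ) :* g :* (f :* (e′ :+ (:- a) :* e))) refl
           a ((- 1ℚ) ^ s) (fromℕ (N !)) (E s) (E (suc s)) ⟩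
    (- 1ℚ) ^ suc s * (fromℕ (N !) * (E (suc s) + - a * E s))
      ≡⟨ cong (λ z → (- 1ℚ) ^ suc s * (fromℕ (N !) * z)) (trans (harmonicExp-suc (suc s)) (1-at-⊛-suc a E s)) ⟨
    (- 1ℚ) ^ suc s * (fromℕ (N !) * harmonicExp N m (suc s)) ∎

-- Binomial coefficients and the final identity

[m+k]Cm*m!*k! : ∀ m k → ((m ℕ.+ k) C m) ℕ.* (m ! ℕ.* k !) ≡ (m ℕ.+ k) !
[m+k]Cm*m!*k! m k = begin
  ((m ℕ.+ k) C m) ℕ.* (m ! ℕ.* k !)
    ≡⟨ cong (λ i → ((m ℕ.+ k) C m) ℕ.* (m ! ℕ.* i !)) (ℕ.m+n∸m≡n m k) ⟨
  ((m ℕ.+ k) C m) ℕ.* (m ! ℕ.* (m ℕ.+ k ∸ m) !)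
    ≡⟨ cong (ℕ._* (m ! ℕ.* (m ℕ.+ k ∸ m) !)) (nCk≡n!/k![n-k]! (ℕ.m≤m+n m k)) ⟩
  ((m ℕ.+ k) ! ℕ./ (m ! ℕ.* (m ℕ.+ k ∸ m) !)) ℕ.* (m ! ℕ.* (m ℕ.+ k ∸ m) !)
    ≡⟨ ℕ.m/n*n≡m (k![n∸k]!∣n! (ℕ.m≤m+n m k)) ⟩
  (m ℕ.+ k) ! ∎
  where instance _ = m ℕ.!* (m ℕ.+ k ∸ m) !≢0

-- Here `(m + n + 1)!` is split as the binomial coefficient times `m! (n + 1) n!`. The `m!` cancels,
-- and `n + 1` stays in front to match `risingD-inverse`.
rStirling₁-harmonicP : ∀ m n s →
  fromℕ (s !) * rStirling₁ (suc m) (suc n) s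
    ≡ fromℕ (suc n) * (fromℕ (n !) * fromℕ ((m ℕ.+ suc n) C m) * harmonicP s (m ℕ.+ suc n) m)
rStirling₁-harmonicP m n s = fromℕ-*-cancelˡ (m !) {{m ℕ.!≢0}} (begin
  fromℕ (m !) * (fromℕ (s !) * rStirling₁ (suc m) (suc n) s)
    ≡⟨ solve 3 (λ x y z → x :* (y :* z) := y :* (x :* z)) refl (fromℕ (m !)) (fromℕ (s !)) (rStirling₁ (suc m) (suc n) s) ⟩
  fromℕ (s !) * (fromℕ (m !) * rStirling₁ (suc m) (suc n) s)
    ≡⟨ cong (fromℕ (s !) *_) (rStirling₁-harmonicExp m (suc n) s) ⟩
  fromℕ (s !) * ((- 1ℚ) ^ s * (fromℕ (N !) * E))
    ≡⟨ cong (λ z → fromℕ (s !) * ((- 1ℚ) ^ s * (z * E))) N!≡ ⟩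
  fromℕ (s !) * ((- 1ℚ) ^ s * (fromℕ (N C m) * (fromℕ (m !) * (fromℕ (suc n) * fromℕ (n !))) * E))
    -- The group `g :* (s! :* e)` is `harmonicP s N m` unfolded.
    ≡⟨ solve 7 (λ s! g c m! n+1 n! e → s! :* (g :* (c :* (m! :* (n+1 :* n!)) :* e)) := m! :* (n+1 :* (n! :* c :* (g :* (s! :* e))))) refl
         (fromℕ (s !)) ((- 1ℚ) ^ s) (fromℕ (N C m)) (fromℕ (m !)) (fromℕ (suc n)) (fromℕ (n !)) E ⟩
  fromℕ (m !) * (fromℕ (suc n) * (fromℕ (n !) * fromℕ (N C m) * harmonicP s N m)) ∎)
  where
  N : ℕ
  N = m ℕ.+ suc n

  E : ℚ
  E = harmonicExp N m s

  N!≡ : fromℕ (N !) ≡ fromℕ (N C m) * (fromℕ (m !) * (fromℕ (suc n) * fromℕ (n !)))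
  N!≡ = begin
    fromℕ (N !)                                                     ≡⟨ cong fromℕ ([m+k]Cm*m!*k! m (suc n)) ⟨
    fromℕ ((N C m) ℕ.* (m ! ℕ.* suc n !))                           ≡⟨ fromℕ-homo-* (N C m) _ ⟩
    fromℕ (N C m) * fromℕ (m ! ℕ.* suc n !)                         ≡⟨ cong (fromℕ (N C m) *_) (fromℕ-homo-* (m !) (suc n !)) ⟩
    fromℕ (N C m) * (fromℕ (m !) * fromℕ (suc n !))                 ≡⟨ cong (λ z → fromℕ (N C m) * (fromℕ (m !) * z)) (fromℕ-homo-* (suc n) (n !)) ⟩
    fromℕ (N C m) * (fromℕ (m !) * (fromℕ (suc n) * fromℕ (n !)))   ∎

-- The bound `2 ≤ q + r` makes the truncated `q + r ∸ 2` an honest `m` with `q + r = 2 + m`. Both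
-- sides are compared after multiplication by `n + 1`, since `risingD-inverse` evaluates that
-- multiple.
theorem6 : ∀ (q r n l : ℕ) → 2 ≤ q ℕ.+ r →
    sumFromTo l n (λ k → rStirling₁ r n k * fromℕ (k P l) * bernoulli (k ∸ l) (fromℕ q))
    ≡ fromℕ (n !) * fromℕ ((n ℕ.+ q ℕ.+ r ∸ 1) C (q ℕ.+ r ∸ 2)) * harmonicP (l ℕ.+ 1) (n ℕ.+ q ℕ.+ r ∸ 1) (q ℕ.+ r ∸ 2)
theorem6 q r n l 2≤q+r = trans (sum-bernoulli q r n l) (fromℕ-*-cancelˡ (suc n) (begin
  fromℕ (suc n) * risingD (q ℕ.+ r) n W 0
    ≡⟨ cong (λ k → fromℕ (suc n) * risingD k n W 0) (ℕ.m+[n∸m]≡n 2≤q+r) ⟨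
  fromℕ (suc n) * risingD (2 ℕ.+ m) n W 0
    ≡⟨ risingD-inverse m n l ⟩
  fromℕ (suc l !) * rStirling₁ (suc m) (suc n) (suc l)
    ≡⟨ rStirling₁-harmonicP m n (suc l) ⟩
  fromℕ (suc n) * (fromℕ (n !) * fromℕ ((m ℕ.+ suc n) C m) * harmonicP (suc l) (m ℕ.+ suc n) m)
    ≡⟨ cong₂ (λ s N → fromℕ (suc n) * (fromℕ (n !) * fromℕ (N C m) * harmonicP s N m)) (ℕ.+-comm 1 l) N≡ ⟩
  fromℕ (suc n) * (fromℕ (n !) * fromℕ ((n ℕ.+ q ℕ.+ r ∸ 1) C m) * harmonicP (l ℕ.+ 1) (n ℕ.+ q ℕ.+ r ∸ 1) m) ∎))
  where
  m : ℕ
  m = q ℕ.+ r ∸ 2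

  W : Series
  W = (indeterminate ^ˢ l) ⊛ inverse [e^t-1]/t

  N≡ : m ℕ.+ suc n ≡ n ℕ.+ q ℕ.+ r ∸ 1
  N≡ = begin
    m ℕ.+ suc n                ≡⟨ ℕ.+-comm m (suc n) ⟩
    suc n ℕ.+ m                ≡⟨ cong (_∸ 1) (trans (ℕ.+-suc n (suc m)) (cong suc (ℕ.+-suc n m))) ⟨
    n ℕ.+ (2 ℕ.+ m) ∸ 1        ≡⟨ cong (λ k → n ℕ.+ k ∸ 1) (ℕ.m+[n∸m]≡n 2≤q+r) ⟩
    n ℕ.+ (q ℕ.+ r) ∸ 1        ≡⟨ cong (_∸ 1) (ℕ.+-assoc n q r) ⟨
    n ℕ.+ q ℕ.+ r ∸ 1          ∎
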